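{- Let $\Phi$ be a reduced, satisfiable 3-XOR-SAT formula with $m$ equations and $n$ variables that is 2-regular and $s$-connected. Then the expected number of steps $T_{RW}$ until the algorithm RandomWalkSat finds a satisfying assignment satisfies \[E[T_{RW}]\leq \min\{m^{3}/(2s),\ 2\log 2\cdot \tau_{C}(T_{3}(\Phi))\cdot m^{2}\}.\]
   Context: A 3-XOR-SAT formula is a list of equations $x_{i_1}\oplus x_{i_2}\oplus x_{i_3}=b$ over Boolean variables; it is satisfiable if some assignment satisfies all equations. It is reduced if no variable appears in a single clause and no two clauses share two variables. It is connected if it cannot be partitioned into two variable-disjoint formulas; it is $k$-connected if deleting up to $k-1$ variables (and the clauses in which they appear) does not disconnect it; it is 2-regular if every variable appears in exactly two clauses. RandomWalkSat: start with an arbitrary assignment; while some clause is unsatisfied, pick a uniformly random unsatisfied clause and flip the value of a uniformly random variable of it. $T_3(\Phi)$ is the graph whose vertices are the clauses of $\Phi$, with an edge joining the two clauses containing each variable. For a graph $H$ on $N$ vertices with $p_{i,j}=1/\deg(i)$ for adjacent $i,j$ and $0$ otherwise, and $\pi[A]=|A|/N$, $\tau_C(H)=\sup_{A\subseteq V}\frac{\pi[A]\,\pi[\overline{A}]}{\sum_{i\in A}\sum_{j\in\overline{A}}\pi[i]p_{i,j}}$.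
   Formalization: s-connected is taken with s ≥ 1 and the usual side condition that there are more than s variables (s < n); without it the formula with T_3(Φ) = K_4 is s-connected for every s and the bound m^3/(2s) fails. -}

module Defs where

open import Level using (0ℓ)
open import Data.Bool using (Bool; not; _xor_; if_then_else_)
import Data.Bool.Properties as Bool
open import Data.Fin using (Fin; _≟_)
open import Data.Fin.Properties using (any?)
open import Data.Fin.Subset using (Subset; ∣_∣; ⁅_⁆; ∁)
import Data.Fin.Subset as Subset
import Data.Fin.Subset.Properties as Subset
open import Data.Integer using (+_)
open import Data.List using (List; []; _∷_; _++_; [_]; map; concatMap; foldr; filter; length; allFin; upTo)
import Data.List as List
open import Data.List.Relation.Unary.All using (All; all?)
open import Data.List.Relation.Unary.Any using (Any)
open import Data.List.Relation.Binary.Permutation.Propositional using (_↭_)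
open import Data.Nat using (ℕ; zero; suc; _<_)
import Data.Nat as ℕ
open import Data.Product using (∃; ∃-syntax; _×_; _,_)
open import Data.Rational using (ℚ; 0ℚ; 1ℚ; _/_; _+_; _*_)
import Data.Rational as ℚ
open import Data.Sum using (_⊎_)
open import Data.Vec using (Vec; lookup; updateAt)
open import Relation.Binary.Definitions using (Symmetric; Irreflexive)
import Relation.Binary as Binary
open import Relation.Binary.PropositionalEquality using (_≡_; _≢_; sym)
open import Relation.Nullary using (¬_; ¬?; does; _×-dec_)
import Relation.Unary as Unary
open import Relation.Unary using (Pred)

fromℕ : ℕ → ℚ
fromℕ k = + k / 1

-- recip 0 is a dummy value: below, recip is applied to the degree of a
-- vertex with a neighbour, the size of a nonempty set, or N + suc i.
recip : ℕ → ℚ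
recip zero    = 0ℚ
recip (suc k) = + 1 / suc k

∑ : {A : Set} → List A → (A → ℚ) → ℚ
∑ xs f = foldr _+_ 0ℚ (map f xs)

-- Extended reals, given by their lower cuts: x is represented by the
-- set of all rationals q < x.  Suprema of arbitrary families of
-- rationals (possibly +∞) live here, and the order is inclusion.
ℝ↓ : Set₁
ℝ↓ = Pred ℚ 0ℓ

infix  4 _≤ᵣ_
infixl 7 _·_ _÷_

_≤ᵣ_ : ℝ↓ → ℝ↓ → Set
x ≤ᵣ y = x Unary.⊆ y

⌜_⌝ : ℚ → ℝ↓
⌜ r ⌝ q = q ℚ.< r

⋁ : {I : Set} → (I → ℝ↓) → ℝ↓
⋁ f q = ∃ λ i → f i q

min : ℝ↓ → ℝ↓ → ℝ↓
min x y = x Unary.∩ y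

-- Product of two nonnegative numbers.
_·_ : ℝ↓ → ℝ↓ → ℝ↓
(x · y) q = q ℚ.< 0ℚ ⊎
  ∃[ a ] ∃[ b ] x a × y b × 0ℚ ℚ.< a × 0ℚ ℚ.< b × q ℚ.< a * b

-- Quotient of two nonnegative rationals: q < a / b iff q * b < a.
-- Thus a ÷ 0 = +∞ for a > 0, while 0 ÷ 0 is the empty cut -∞, which
-- contributes nothing to a supremum.
_÷_ : ℚ → ℚ → ℝ↓
(a ÷ b) q = q * b ℚ.< a

-- log 2 = ∫₁² dx/x, as the supremum of the lower Riemann sums
-- ∑_{i=1}^{N} (1/N) · 1/(1 + i/N) = ∑_{i=1}^{N} 1/(N + i).
log2 : ℝ↓
log2 = ⋁ λ N → ⌜ ∑ (upTo N) (λ i → recip (N ℕ.+ suc i)) ⌝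

record Equation (n : ℕ) : Set where
  field
    x₁ x₂ x₃ : Fin n
    rhs      : Bool
    x₁≢x₂    : x₁ ≢ x₂
    x₁≢x₃    : x₁ ≢ x₃
    x₂≢x₃    : x₂ ≢ x₃

open Equation public

Formula : ℕ → Set
Formula n = List (Equation n)

Assignment : ℕ → Set
Assignment n = Vec Bool n

module _ {n : ℕ} where

  open import Data.List.Membership.DecPropositional (_≟_ {n}) using (_∈_; _∈?_)

  vars : Equation n → List (Fin n)
  vars e = x₁ e ∷ x₂ e ∷ x₃ e ∷ []

  Satisfies : Assignment n → Equation n → Set
  Satisfies σ e = lookup σ (x₁ e) xor (lookup σ (x₂ e) xor lookup σ (x₃ e)) ≡ rhs e

  satisfies? : ∀ σ → Unary.Decidable (Satisfies σ)
  satisfies? σ e = _ Bool.≟ _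

  Satisfiable : Formula n → Set
  Satisfiable Φ = ∃[ σ ] All (Satisfies σ) Φ

  occurrences : Formula n → Fin n → ℕ
  occurrences Φ v = length (filter (λ e → v ∈? vars e) Φ)

  Reduced : Formula n → Set
  Reduced Φ =
    (∀ v → occurrences Φ v ≢ 1) ×
    (∀ (i j : Fin (length Φ)) → i ≢ j → ∀ v w → v ≢ w →
       ¬ (v ∈ vars (List.lookup Φ i) × v ∈ vars (List.lookup Φ j) ×
          w ∈ vars (List.lookup Φ i) × w ∈ vars (List.lookup Φ j)))

  2-Regular : Formula n → Set
  2-Regular Φ = ∀ v → occurrences Φ v ≡ 2

  VariableDisjoint : Formula n → Formula n → Set
  VariableDisjoint Φ Ψ =
    ∀ v → ¬ (Any (λ e → v ∈ vars e) Φ × Any (λ e → v ∈ vars e) Ψ)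

  Connected : Formula n → Set
  Connected Φ = ∀ Ψ₁ Ψ₂ → Φ ↭ Ψ₁ ++ Ψ₂ → VariableDisjoint Ψ₁ Ψ₂ →
    Ψ₁ ≡ [] ⊎ Ψ₂ ≡ []

  delete : Subset n → Formula n → Formula n
  delete D = filter (λ e → all? (λ v → ¬? (v Subset.∈? D)) (vars e))

  -- As usual for k-connectivity there must be more than k elements to
  -- delete from; otherwise a formula on four clauses, any two of which
  -- share a variable, would be k-connected for every k.
  _-Connected_ : ℕ → Formula n → Set
  k -Connected Φ = k < n × (∀ (D : Subset n) → ∣ D ∣ < k → Connected (delete D Φ))

record Graph (N : ℕ) : Set₁ where
  field
    _~_    : Fin N → Fin N → Set
    _~?_   : Binary.Decidable _~_
    ~-sym  : Symmetric _~_
    ~-irr  : Irreflexive _≡_ _~_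

module _ {N : ℕ} (H : Graph N) where

  open Graph H

  deg : Fin N → ℕ
  deg i = length (filter (i ~?_) (allFin N))

  p : Fin N → Fin N → ℚ
  p i j = if does (i ~? j) then recip (deg i) else 0ℚ

  π : Subset N → ℚ
  π A = fromℕ ∣ A ∣ * recip N

  elements : Subset N → List (Fin N)
  elements A = filter (Subset._∈? A) (allFin N)

  τ-C : ℝ↓
  τ-C = ⋁ λ (A : Subset N) →
    (π A * π (∁ A)) ÷
    ∑ (elements A) (λ i → ∑ (elements (∁ A)) (λ j → π ⁅ i ⁆ * p i j))

module _ {n : ℕ} where

  open import Data.List.Membership.DecPropositional (_≟_ {n}) using (_∈_; _∈?_)

  T₃ : (Φ : Formula n) → Graph (length Φ)
  T₃ Φ = record
    { _~_   = λ i j → i ≢ j × ∃ λ v → v ∈ clause i × v ∈ clause j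
    ; _~?_  = λ i j → ¬? (i ≟ j) ×-dec
                      any? (λ v → v ∈? clause i ×-dec v ∈? clause j)
    ; ~-sym = λ (i≢j , v , v∈i , v∈j) → (λ j≡i → i≢j (sym j≡i)) , v , v∈j , v∈i
    ; ~-irr = λ i≡j (i≢j , _) → i≢j i≡j
    }
    where
    clause : Fin (length Φ) → List (Fin n)
    clause i = vars (List.lookup Φ i)

-- Finitely supported probability distributions, as weighted outcomes.
Dist : Set → Set
Dist A = List (ℚ × A)

return : {A : Set} → A → Dist A
return a = [ 1ℚ , a ]

infixl 1 _>>=_
_>>=_ : {A B : Set} → Dist A → (A → Dist B) → Dist B
d >>= f = concatMap (λ (w , a) → map (λ (w′ , b) → w * w′ , b) (f a)) d

uniform : {A : Set} → List A → Dist A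
uniform xs = map (λ x → recip (length xs) , x) xs

𝔼 : {A : Set} → Dist A → (A → ℚ) → ℚ
𝔼 d f = ∑ d (λ (w , a) → w * f a)

module _ {n : ℕ} (Φ : Formula n) where

  unsatisfied : Assignment n → List (Equation n)
  unsatisfied σ = filter (λ e → ¬? (satisfies? σ e)) Φ

  -- The distribution of min(T_RW, t), where T_RW is the number of steps
  -- of RandomWalkSat started at σ.
  steps : ℕ → Assignment n → Dist ℕ
  steps zero    σ = return 0
  steps (suc t) σ with unsatisfied σ
  ... | []         = return 0
  ... | us@(_ ∷ _) = do
    e ← uniform us
    v ← uniform (vars e)
    k ← steps t (updateAt σ v not)
    return (suc k)

  -- E[T_RW] = sup_t E[min(T_RW, t)], by monotone convergence; it is +∞
  -- if the algorithm fails to stop with positive probability.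
  E[T-RW] : Assignment n → ℝ↓
  E[T-RW] σ = ⋁ λ t → ⌜ 𝔼 (steps t σ) fromℕ ⌝

-- Flipping a variable of a violated clause moves the violation to the adjacent clause of T₃(Φ),
-- where it annihilates with a violation already present.  The parity χ(σ,B) of the number of
-- clauses of a set B violated by σ turns this walk into its dual, the voter model, in which a
-- clause copies its membership in B from a neighbour.  Satisfiability makes χ(σ,B) vanish for
-- B = ∅ and for the set B of all clauses, the absorbing states of the voter model.  Hence the sum
-- over all clauses x of the potential of χ(σ,·) for the voter model started at {x} decreases by at
-- least m on average in every step of RandomWalkSat, up to the error of truncating the potential
-- at a finite time.  Since |B|(m - |B|) decreases on average by the cut of B divided by 3m/2, a
-- lower bound c on all cuts bounds the potential, and E[T] ≤ 3m(m - 1)/(2c).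
--
-- For the first bound, c = 1 suffices if m ≥ 8 because s ≤ 3 as soon as m ≥ 5, and c = 3 holds if
-- m ≤ 7 by counting degrees.  For the second, a smallest cut gives τ_C ≥ 3(m - 1)/(mc), so that
-- E[T] ≤ m² τ_C / 2, while 2 log 2 > 1.

module Submission where

open import Defs
open import Level using (0ℓ)
open import Algebra.Bundles using (CommutativeMonoid; CommutativeRing)
open import Data.Bool using (Bool; true; false; not; _xor_; _∧_; if_then_else_)
import Data.Bool.Properties as Bool
open import Data.Fin using (Fin; zero; suc; _≟_)
open import Data.Fin.Properties using (any?)
open import Data.Fin.Subset using (Subset; ⊥; ⊤; ⁅_⁆; ∣_∣; ∁; _∪_) renaming (_∈_ to _∈ˢ_)
import Data.Fin.Subset.Properties as Subset
open import Data.Integer as ℤ using (+_; +[1+_]; -[1+_])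
import Data.Integer.Properties as ℤ
open import Data.List using (List; []; _∷_; _++_; map; concatMap; filter; foldr; length; allFin; upTo; lookup)
import Data.List.Properties as List
open import Data.List.Membership.Propositional using (_∈_; _∉_; find; lose)
open import Data.List.Membership.Propositional.Properties using (∈-lookup; ∈-filter⁺; ∈-filter⁻)
open import Data.List.Relation.Binary.Permutation.Propositional using (_↭_; ↭-refl; ↭-trans; ↭-sym; prep)
open import Data.List.Relation.Binary.Permutation.Propositional.Properties using (shift)
open import Data.List.Relation.Unary.All using (All)
import Data.List.Relation.Unary.All as All
open import Data.List.Relation.Unary.Any using (here; there)
import Data.List.Relation.Unary.Any as Any
open import Data.List.Relation.Unary.Any.Properties using (lookup-index)
open import Data.Nat as ℕ using (ℕ; zero; suc; _^_; _≥_)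
import Data.Nat.Coprimality as Coprime
import Data.Nat.Properties as ℕ
import Data.Nat.Tactic.RingSolver as ℕ-Solver
open import Data.Product using (∃; ∃₂; _×_; _,_; proj₁; proj₂)
open import Data.Rational using (ℚ; mkℚ; 0ℚ; 1ℚ; _/_; _+_; _*_; -_; _-_; 1/_; _≤_; _<_; *≤*; *<*; nonNegative; positive)
import Data.Rational as ℚ
open import Data.Rational.Properties hiding (_≟_)
open import Data.Sum using (_⊎_; inj₁; inj₂; [_,_]′)
import Data.Sum as Sum
open import Data.Unit using (tt)
open import Data.Vec using ([]; _∷_; updateAt; _[_]≔_)
import Data.Vec as Vec
import Data.Vec.Properties as Vec
open import Function using (_∘_)
open import Relation.Binary.PropositionalEquality using (_≡_; _≢_; refl; sym; trans; cong; cong₂; subst; subst₂; ≢-sym; module ≡-Reasoning)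
open import Relation.Nullary using (Dec; yes; no; does; ¬_; ¬?; contradiction; _×-dec_)
open import Relation.Nullary.Decidable using (dec⇒maybe; dec-true; dec-false; decidable-stable; toWitness)
open import Relation.Unary using (Pred; Decidable)
open import Tactic.RingSolver using (solve-∀)
open import Tactic.RingSolver.Core.AlmostCommutativeRing using (AlmostCommutativeRing; fromCommutativeRing)

-- The voter model draws one of the 3m pairs of a clause and a variable in it, whereas RandomWalkSat
-- draws only from violated clauses. The two are compared through a lazy walk that draws any pair
-- and idles if the clause is satisfied. Under it the potential summed over singletons drops by the
-- number u of violated clauses, up to the truncation error. RandomWalkSat is this walk without the
-- idle steps, hence faster by the factor m/u, and drops by m whatever the assignment. Each of the m
-- singletons has potential at most 3m(m - 1)/(2c), so the factor m cancels. The obstacle is that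
-- the potential is an infinite series and that the running time is not known in advance to be
-- finite. So both are truncated, the running time at `t` and the series after `N` terms. The
-- missing tail is controlled by |B|(m - |B|), whose averages after k voter steps do not increase
-- with k and have bounded partial sums, so that the N-th is O(1/N). As `t` stays fixed, an
-- Archimedean argument inside the rationals replaces the limit in N.

ℚ-ring : AlmostCommutativeRing 0ℓ 0ℓ
ℚ-ring = fromCommutativeRing +-*-commutativeRing λ x → dec⇒maybe (0ℚ ℚ.≟ x)

-- Rational arithmetic and an Archimedean limit argument

fromℕ≡mkℚ : ∀ k → fromℕ k ≡ mkℚ (+ k) 0 (Coprime.sym (Coprime.1-coprimeTo k))
fromℕ≡mkℚ k = normalize-coprime (Coprime.sym (Coprime.1-coprimeTo k))

fromℕ-+ : ∀ a b → fromℕ (a ℕ.+ b) ≡ fromℕ a + fromℕ b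
fromℕ-+ a b = sym (trans (cong₂ _+_ (fromℕ≡mkℚ a) (fromℕ≡mkℚ b))
  (cong (ℚ._/ 1) (cong₂ ℤ._+_ (ℤ.*-identityʳ (+ a)) (ℤ.*-identityʳ (+ b)))))

fromℕ-* : ∀ a b → fromℕ (a ℕ.* b) ≡ fromℕ a * fromℕ b
fromℕ-* a b = sym (trans (cong₂ _*_ (fromℕ≡mkℚ a) (fromℕ≡mkℚ b))
  (cong (ℚ._/ 1) (sym (ℤ.pos-* a b))))

fromℕ-suc : ∀ k → fromℕ (suc k) ≡ 1ℚ + fromℕ k
fromℕ-suc = fromℕ-+ 1

fromℕ-mono-≤ : ∀ {a b} → a ℕ.≤ b → fromℕ a ≤ fromℕ b
fromℕ-mono-≤ {a} {b} a≤b = subst₂ _≤_ (sym (fromℕ≡mkℚ a)) (sym (fromℕ≡mkℚ b))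
  (*≤* (ℤ.*-monoʳ-≤-nonNeg (+ 1) (ℤ.+≤+ a≤b)))

fromℕ-cancel-≤ : ∀ {a b} → fromℕ a ≤ fromℕ b → a ℕ.≤ b
fromℕ-cancel-≤ {a} {b} a≤b with subst₂ _≤_ (fromℕ≡mkℚ a) (fromℕ≡mkℚ b) a≤b
... | *≤* le = ℤ.drop‿+≤+ (ℤ.*-cancelʳ-≤-pos _ _ (+ 1) le)

fromℕ-injective : ∀ {a b} → fromℕ a ≡ fromℕ b → a ≡ b
fromℕ-injective eq = ℕ.≤-antisym (fromℕ-cancel-≤ (≤-reflexive eq)) (fromℕ-cancel-≤ (≤-reflexive (sym eq)))

0≤fromℕ : ∀ k → 0ℚ ≤ fromℕ k
0≤fromℕ k = fromℕ-mono-≤ {0} {k} ℕ.z≤n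

0<fromℕ-suc : ∀ k → 0ℚ < fromℕ (suc k)
0<fromℕ-suc k = <-≤-trans (*<* (ℤ.+<+ (ℕ.s≤s ℕ.z≤n))) (fromℕ-mono-≤ {1} {suc k} (ℕ.s≤s ℕ.z≤n))

recip≡mkℚ : ∀ k → recip (suc k) ≡ mkℚ (+ 1) k (Coprime.1-coprimeTo (suc k))
recip≡mkℚ k = normalize-coprime (Coprime.1-coprimeTo (suc k))

recip-inverse : ∀ k → recip (suc k) * fromℕ (suc k) ≡ 1ℚ
recip-inverse k = trans (cong₂ _*_ (recip≡mkℚ k) (fromℕ≡mkℚ (suc k)))
  (*-inverseˡ (mkℚ +[1+ k ] 0 (Coprime.sym (Coprime.1-coprimeTo (suc k)))))

0≤recip : ∀ k → 0ℚ ≤ recip k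
0≤recip zero    = ≤-refl
0≤recip (suc k) = subst (0ℚ ≤_) (sym (recip≡mkℚ k)) (*≤* (ℤ.+≤+ ℕ.z≤n))

<⇒≱ : ∀ {p q} → p < q → ¬ q ≤ p
<⇒≱ p<q q≤p = <-irrefl refl (<-≤-trans p<q q≤p)

0≤+ : ∀ {x y} → 0ℚ ≤ x → 0ℚ ≤ y → 0ℚ ≤ x + y
0≤+ = +-mono-≤

*ˡ-mono : ∀ {r p q} → 0ℚ ≤ r → p ≤ q → r * p ≤ r * q
*ˡ-mono {r} 0≤r = *-monoˡ-≤-nonNeg r {{nonNegative 0≤r}}

*ʳ-mono : ∀ {r p q} → 0ℚ ≤ r → p ≤ q → p * r ≤ q * r
*ʳ-mono {r} 0≤r = *-monoʳ-≤-nonNeg r {{nonNegative 0≤r}}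

*ˡ-cancel : ∀ {r p q} → 0ℚ < r → r * p ≤ r * q → p ≤ q
*ˡ-cancel {r} 0<r = *-cancelˡ-≤-pos r {{positive 0<r}}

*ˡ-mono-< : ∀ {r p q} → 0ℚ < r → p < q → r * p < r * q
*ˡ-mono-< {r} 0<r = *-monoʳ-<-pos r {{positive 0<r}}

*ʳ-mono-< : ∀ {r p q} → 0ℚ < r → p < q → p * r < q * r
*ʳ-mono-< {r} 0<r = *-monoˡ-<-pos r {{positive 0<r}}

0≤* : ∀ {x y} → 0ℚ ≤ x → 0ℚ ≤ y → 0ℚ ≤ x * y
0≤* {x} {y} 0≤x 0≤y = subst (_≤ x * y) (*-zeroʳ x) (*ˡ-mono 0≤x 0≤y)

0<* : ∀ {x y} → 0ℚ < x → 0ℚ < y → 0ℚ < x * y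
0<* {x} {y} 0<x 0<y = subst (_< x * y) (*-zeroʳ x) (*ˡ-mono-< 0<x 0<y)

p≤q⇒0≤q-p : ∀ {p q} → p ≤ q → 0ℚ ≤ q - p
p≤q⇒0≤q-p {p} {q} p≤q = subst (_≤ q - p) (+-inverseʳ p) (+-monoˡ-≤ (- p) p≤q)

p<q⇒0<q-p : ∀ {p q} → p < q → 0ℚ < q - p
p<q⇒0<q-p {p} {q} p<q = subst (_< q - p) (+-inverseʳ p) (+-monoˡ-< (- p) p<q)

p≤p+q : ∀ {p q} → 0ℚ ≤ q → p ≤ p + q
p≤p+q {p} {q} 0≤q = subst (_≤ p + q) (+-identityʳ p) (+-monoʳ-≤ p 0≤q)

-- Reduces an inequality to a ring identity: `r` is the difference, written so that its sign is
-- evident, and the solver checks the rest.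
diff : ∀ {p q r} → 0ℚ ≤ r → q ≡ p + r → p ≤ q
diff 0≤r eq = ≤-trans (p≤p+q 0≤r) (≤-reflexive (sym eq))

-- A positive `x` with denominator d + 1 is at least 1/(d + 1), and `y` with numerator n is below
-- |n| + 1, so the product of these two integers serves as `N`.
archimedean : ∀ {x} → 0ℚ < x → ∀ y → ∃ λ N → y < fromℕ N * x
archimedean {x@(mkℚ +[1+ a ] d _)} 0<x y@(mkℚ n e _) = suc ℤ.∣ n ∣ ℕ.* suc d , (begin-strict
  y                                                   <⟨ y<∣y∣+1 ⟩
  fromℕ (suc ℤ.∣ n ∣)                                 ≡⟨ *-identityʳ _ ⟨
  fromℕ (suc ℤ.∣ n ∣) * 1ℚ                            ≡⟨ cong (fromℕ (suc ℤ.∣ n ∣) *_) (recip-inverse d) ⟨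
  fromℕ (suc ℤ.∣ n ∣) * (recip (suc d) * fromℕ (suc d)) ≤⟨ *ˡ-mono (0≤fromℕ (suc ℤ.∣ n ∣)) (*ʳ-mono (0≤fromℕ (suc d)) recip≤x) ⟩
  fromℕ (suc ℤ.∣ n ∣) * (x * fromℕ (suc d))           ≡⟨ rearrange (fromℕ (suc ℤ.∣ n ∣)) x (fromℕ (suc d)) ⟩
  fromℕ (suc ℤ.∣ n ∣) * fromℕ (suc d) * x             ≡⟨ cong (_* x) (fromℕ-* (suc ℤ.∣ n ∣) (suc d)) ⟨
  fromℕ (suc ℤ.∣ n ∣ ℕ.* suc d) * x                   ∎)
  where
  open ≤-Reasoning
  rearrange : ∀ a b c → a * (b * c) ≡ a * c * b
  rearrange = solve-∀ ℚ-ring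
  recip≤x : recip (suc d) ≤ x
  recip≤x = subst (_≤ x) (sym (recip≡mkℚ d)) (*≤* (ℤ.*-monoʳ-≤-nonNeg (+ suc d) (ℤ.+≤+ {1} {suc a} (ℕ.s≤s ℕ.z≤n))))
  i<1+∣i∣ : ∀ i → i ℤ.< + suc ℤ.∣ i ∣
  i<1+∣i∣ (+ k)    = ℤ.+<+ ℕ.≤-refl
  i<1+∣i∣ -[1+ k ] = ℤ.-<+
  y<∣y∣+1 : y < fromℕ (suc ℤ.∣ n ∣)
  y<∣y∣+1 = subst (y <_) (sym (fromℕ≡mkℚ (suc ℤ.∣ n ∣))) (*<* (ℤ.<-≤-trans
    (subst (ℤ._< + suc ℤ.∣ n ∣) (sym (ℤ.*-identityʳ n)) (i<1+∣i∣ n))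
    (subst (ℤ._≤ + suc ℤ.∣ n ∣ ℤ.* + suc e) (ℤ.*-identityʳ (+ suc ℤ.∣ n ∣))
      (ℤ.*-monoˡ-≤-nonNeg (+ suc ℤ.∣ n ∣) (ℤ.+≤+ (ℕ.s≤s ℕ.z≤n))))))
archimedean {mkℚ (+ 0) _ _} (*<* (ℤ.+<+ ()))
archimedean {mkℚ -[1+ _ ] _ _} (*<* ())

-- Stands in for the limit N → ∞. The hypotheses make ε of order 1/N, while a gap Y - Z > 0 could be
-- at most ε · Y for every N. `0ℚ ≤ Z` makes `Y` nonnegative in the case to be refuted.
vanishing-error : ∀ {Y Z γ C} → 0ℚ < γ → 0ℚ ≤ Z →
  (∀ N → ∃ λ ε → Y - ε * Y ≤ Z × γ * (fromℕ N * ε) ≤ C) → Y ≤ Z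
vanishing-error {Y} {Z} {γ} {C} 0<γ 0≤Z approx = ≮⇒≥ λ Z<Y →
  let N , C*Y<N*x = archimedean (0<* 0<γ (p<q⇒0<q-p Z<Y)) (C * Y)
      ε , Y-εY≤Z , Nε≤C = approx N
  in <⇒≱ C*Y<N*x (begin
    fromℕ N * (γ * (Y - Z))   ≤⟨ *ˡ-mono (0≤fromℕ N) (*ˡ-mono (<⇒≤ 0<γ) (diff (p≤q⇒0≤q-p Y-εY≤Z) (rearrange Y Z ε))) ⟩
    fromℕ N * (γ * (ε * Y))   ≡⟨ regroup (fromℕ N) γ ε Y ⟩
    γ * (fromℕ N * ε) * Y     ≤⟨ *ʳ-mono (≤-trans 0≤Z (<⇒≤ Z<Y)) Nε≤C ⟩
    C * Y                     ∎)
  where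
  open ≤-Reasoning
  rearrange : ∀ Y Z e → e * Y ≡ Y - Z + (Z - (Y - e * Y))
  rearrange = solve-∀ ℚ-ring
  regroup : ∀ N γ e Y → N * (γ * (e * Y)) ≡ γ * (N * e) * Y
  regroup = solve-∀ ℚ-ring

-- Finite sums over a commutative monoid

module BigSum (M : CommutativeMonoid 0ℓ 0ℓ) where
  open CommutativeMonoid M renaming (refl to ≈-refl; sym to ≈-sym; trans to ≈-trans; reflexive to ≈-reflexive)
  open import Relation.Binary.Reasoning.Setoid setoid
  open import Algebra.Properties.CommutativeSemigroup commutativeSemigroup using (interchange)

  -- The monoid is a parameter because the same rearrangements serve rational sums and parities. The
  -- body copies that of `∑`, so that over the rationals the two agree definitionally.
  sum : {A : Set} → List A → (A → Carrier) → Carrier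
  sum xs f = foldr _∙_ ε (map f xs)

  infixr 8 _▷_
  _▷_ : Bool → Carrier → Carrier
  b ▷ x = if b then x else ε

  sum-cong : {A : Set} (xs : List A) {f g : A → Carrier} → (∀ x → f x ≈ g x) → sum xs f ≈ sum xs g
  sum-cong []       f≈g = ≈-refl
  sum-cong (x ∷ xs) f≈g = ∙-cong (f≈g x) (sum-cong xs f≈g)

  sum-ε : {A : Set} (xs : List A) → sum xs (λ _ → ε) ≈ ε
  sum-ε []       = ≈-refl
  sum-ε (x ∷ xs) = ≈-trans (identityˡ _) (sum-ε xs)

  sum-∙ : {A : Set} (xs : List A) (f g : A → Carrier) → sum xs (λ x → f x ∙ g x) ≈ sum xs f ∙ sum xs g
  sum-∙ []       f g = ≈-sym (identityˡ ε)
  sum-∙ (x ∷ xs) f g = ≈-trans (∙-congˡ (sum-∙ xs f g)) (interchange (f x) (g x) (sum xs f) (sum xs g))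

  sum-swap : {A B : Set} (xs : List A) (ys : List B) (f : A → B → Carrier) →
    sum xs (λ x → sum ys (f x)) ≈ sum ys (λ y → sum xs (λ x → f x y))
  sum-swap []       ys f = ≈-sym (sum-ε ys)
  sum-swap (x ∷ xs) ys f = ≈-trans (∙-congˡ (sum-swap xs ys f)) (≈-sym (sum-∙ ys (f x) _))

  sum-map : {A B : Set} (h : A → B) (xs : List A) (f : B → Carrier) → sum (map h xs) f ≡ sum xs (f ∘ h)
  sum-map h xs f = cong (foldr _∙_ ε) (sym (List.map-∘ xs))

  sum-++ : {A : Set} (xs ys : List A) (f : A → Carrier) → sum (xs ++ ys) f ≈ sum xs f ∙ sum ys f
  sum-++ []       ys f = ≈-sym (identityˡ _)
  sum-++ (x ∷ xs) ys f = ≈-trans (∙-congˡ (sum-++ xs ys f)) (≈-sym (assoc _ _ _))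

  sum-concatMap : {A B : Set} (h : A → List B) (xs : List A) (f : B → Carrier) →
    sum (concatMap h xs) f ≈ sum xs (λ x → sum (h x) f)
  sum-concatMap h []       f = ≈-refl
  sum-concatMap h (x ∷ xs) f = ≈-trans (sum-++ (h x) _ f) (∙-congˡ (sum-concatMap h xs f))

  sum-filter : {A : Set} {P : Pred A 0ℓ} (P? : Decidable P) (xs : List A) (f : A → Carrier) →
    sum (filter P? xs) f ≈ sum xs (λ x → does (P? x) ▷ f x)
  sum-filter P? []       f = ≈-refl
  sum-filter P? (x ∷ xs) f with does (P? x)
  ... | true  = ∙-congˡ (sum-filter P? xs f)
  ... | false = ≈-trans (sum-filter P? xs f) (≈-sym (identityˡ _))

  sum-allFin-suc : ∀ {k} (f : Fin (suc k) → Carrier) → sum (allFin (suc k)) f ≡ f zero ∙ sum (allFin k) (f ∘ suc)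
  sum-allFin-suc f = cong (f zero ∙_) (trans (cong (λ zs → sum zs f) (sym (List.map-tabulate (λ i → i) suc)))
    (sum-map suc (allFin _) f))

  sum-δ : ∀ {k} (i : Fin k) (f : Fin k → Carrier) → sum (allFin k) (λ j → does (j ≟ i) ▷ f j) ≈ f i
  sum-δ {suc k} zero    f = begin
    _                        ≡⟨ sum-allFin-suc (λ j → does (j ≟ zero) ▷ f j) ⟩
    f zero ∙ sum (allFin k) (λ _ → ε) ≈⟨ ∙-congˡ (sum-ε (allFin k)) ⟩
    f zero ∙ ε               ≈⟨ identityʳ _ ⟩
    f zero                   ∎
  sum-δ (suc i) f = begin
    _                        ≡⟨ sum-allFin-suc (λ j → does (j ≟ suc i) ▷ f j) ⟩
    ε ∙ _                    ≈⟨ identityˡ _ ⟩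
    sum (allFin _) (λ j → does (j ≟ i) ▷ f (suc j)) ≈⟨ sum-δ i (f ∘ suc) ⟩
    f (suc i)                ∎

  sum-lookup : {A : Set} (xs : List A) (f : A → Carrier) → sum xs f ≡ sum (allFin (length xs)) (f ∘ lookup xs)
  sum-lookup xs f = trans (cong (λ zs → sum zs f) (sym (trans (List.map-tabulate (λ i → i) (lookup xs)) (List.tabulate-lookup xs))))
    (sum-map (lookup xs) (allFin _) f)

module ℚΣ = BigSum +-0-commutativeMonoid

∑-mono : {A : Set} (xs : List A) {f g : A → ℚ} → (∀ x → f x ≤ g x) → ∑ xs f ≤ ∑ xs g
∑-mono []       f≤g = ≤-refl
∑-mono (x ∷ xs) f≤g = +-mono-≤ (f≤g x) (∑-mono xs f≤g)

0≤∑ : {A : Set} (xs : List A) {f : A → ℚ} → (∀ x → 0ℚ ≤ f x) → 0ℚ ≤ ∑ xs f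
0≤∑ xs {f} 0≤f = subst (_≤ ∑ xs f) (ℚΣ.sum-ε xs) (∑-mono xs 0≤f)

∑-*ˡ : {A : Set} (c : ℚ) (xs : List A) (f : A → ℚ) → ∑ xs (λ x → c * f x) ≡ c * ∑ xs f
∑-*ˡ c []       f = sym (*-zeroʳ c)
∑-*ˡ c (x ∷ xs) f = trans (cong (λ z → c * f x + z) (∑-*ˡ c xs f)) (sym (*-distribˡ-+ c (f x) (∑ xs f)))

∑-const : {A : Set} (c : ℚ) (xs : List A) → ∑ xs (λ _ → c) ≡ fromℕ (length xs) * c
∑-const c []       = sym (*-zeroˡ c)
∑-const c (x ∷ xs) = trans (cong (λ z → c + z) (∑-const c xs)) (trans (distrib c (fromℕ (length xs)))
  (cong (_* c) (sym (fromℕ-suc (length xs)))))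
  where
  distrib : ∀ c k → c + k * c ≡ (1ℚ + k) * c
  distrib = solve-∀ ℚ-ring

-- Averaging operators, truncated potentials and duality of chains

module Average {T M : Set} (moves : List M) (w : ℚ) (0≤w : 0ℚ ≤ w) (act : M → T → T) where

  P : (T → ℚ) → T → ℚ
  P h B = w * ∑ moves (λ μ → h (act μ B))

  P^ : ℕ → (T → ℚ) → T → ℚ
  P^ zero    h = h
  P^ (suc N) h = P (P^ N h)

  -- The potential (Green function) of `h`, truncated to its first N terms: h + P h + ... + P^(N-1)
  -- h.
  R : ℕ → (T → ℚ) → T → ℚ
  R zero    h B = 0ℚ
  R (suc N) h B = h B + P (R N h) B

  P-cong : ∀ {f g} → (∀ B → f B ≡ g B) → ∀ B → P f B ≡ P g B
  P-cong f≡g B = cong (w *_) (ℚΣ.sum-cong moves λ μ → f≡g (act μ B))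

  P-mono : ∀ {f g} → (∀ B → f B ≤ g B) → ∀ B → P f B ≤ P g B
  P-mono f≤g B = *ˡ-mono 0≤w (∑-mono moves λ μ → f≤g (act μ B))

  P-+ : ∀ f g B → P (λ C → f C + g C) B ≡ P f B + P g B
  P-+ f g B = trans (cong (w *_) (ℚΣ.sum-∙ moves _ _)) (*-distribˡ-+ w _ _)

  P-*ˡ : ∀ c f B → P (λ C → c * f C) B ≡ c * P f B
  P-*ˡ c f B = trans (cong (w *_) (∑-*ˡ c moves _)) (swap w c (∑ moves λ μ → f (act μ B)))
    where
    swap : ∀ w c s → w * (c * s) ≡ c * (w * s)
    swap = solve-∀ ℚ-ring

  0≤P : ∀ {f} → (∀ B → 0ℚ ≤ f B) → ∀ B → 0ℚ ≤ P f B
  0≤P 0≤f B = 0≤* 0≤w (0≤∑ moves λ μ → 0≤f (act μ B))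

  0≤P^ : ∀ N {f} → (∀ B → 0ℚ ≤ f B) → ∀ B → 0ℚ ≤ P^ N f B
  0≤P^ zero    0≤f = 0≤f
  0≤P^ (suc N) 0≤f = 0≤P (0≤P^ N 0≤f)

  0≤R : ∀ N {f} → (∀ B → 0ℚ ≤ f B) → ∀ B → 0ℚ ≤ R N f B
  0≤R zero    0≤f B = ≤-refl
  0≤R (suc N) 0≤f B = 0≤+ (0≤f B) (0≤P (0≤R N 0≤f) B)

  P^-mono : ∀ N {f g} → (∀ B → f B ≤ g B) → ∀ B → P^ N f B ≤ P^ N g B
  P^-mono zero    f≤g = f≤g
  P^-mono (suc N) f≤g = P-mono (P^-mono N f≤g)

  -- Both sides are the partial sum with N + 1 terms, split at its first and at its last term. Thus
  -- the truncated potential solves Poisson's equation up to the error `P^ N h`.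
  R-telescope : ∀ N h B → h B + P (R N h) B ≡ R N h B + P^ N h B
  R-telescope zero    h B = begin
    h B + P (R zero h) B  ≡⟨ cong (λ z → h B + w * z) (ℚΣ.sum-ε moves) ⟩
    h B + w * 0ℚ          ≡⟨ swap (h B) w ⟩
    0ℚ + h B              ∎
    where
    open ≡-Reasoning
    swap : ∀ h w → h + w * 0ℚ ≡ 0ℚ + h
    swap = solve-∀ ℚ-ring
  R-telescope (suc N) h B = begin
    h B + P (R (suc N) h) B                ≡⟨ cong (λ z → h B + z) (P-cong (R-telescope N h) B) ⟩
    h B + P (λ C → R N h C + P^ N h C) B   ≡⟨ cong (λ z → h B + z) (P-+ (R N h) (P^ N h) B) ⟩
    h B + (P (R N h) B + P^ (suc N) h B)   ≡⟨ +-assoc (h B) _ _ ⟨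
    R (suc N) h B + P^ (suc N) h B         ∎
    where open ≡-Reasoning

  -- A Lyapunov argument: the hypothesis telescopes along the chain. Keeping the remainder `P^ N φ`
  -- on the left is what closes the induction.
  potential-bound : ∀ c h φ → (∀ B → c * h B + P φ B ≤ φ B) → ∀ N B → c * R N h B + P^ N φ B ≤ φ B
  potential-bound c h φ super zero    B = ≤-reflexive (drop c (φ B))
    where
    drop : ∀ c p → c * 0ℚ + p ≡ p
    drop = solve-∀ ℚ-ring
  potential-bound c h φ super (suc N) B = begin
    c * (h B + P (R N h) B) + P (P^ N φ) B          ≡⟨ expand c (h B) (P (R N h) B) (P (P^ N φ) B) ⟩
    c * h B + (c * P (R N h) B + P (P^ N φ) B)      ≡⟨ cong (λ z → c * h B + (z + P (P^ N φ) B)) (P-*ˡ c (R N h) B) ⟨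
    c * h B + (P (λ C → c * R N h C) B + P (P^ N φ) B) ≡⟨ cong (λ z → c * h B + z) (P-+ (λ C → c * R N h C) (P^ N φ) B) ⟨
    c * h B + P (λ C → c * R N h C + P^ N φ C) B    ≤⟨ +-monoʳ-≤ (c * h B) (P-mono (potential-bound c h φ super N) B) ⟩
    c * h B + P φ B                                 ≤⟨ super B ⟩
    φ B                                             ∎
    where
    open ≤-Reasoning
    expand : ∀ c h r p → c * (h + r) + p ≡ c * h + (c * r + p)
    expand = solve-∀ ℚ-ring

  P^-superharmonic : ∀ {φ} → (∀ B → P φ B ≤ φ B) → ∀ N B → P^ N φ B ≤ φ B
  P^-superharmonic super zero    B = ≤-refl
  P^-superharmonic super (suc N) B = ≤-trans (P-mono (P^-superharmonic super N) B) (super B)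

  -- The averages of a superharmonic function do not increase with time, so each of the N terms of
  -- `R N φ` is at least `P^ N φ`. Any bound on the potential thereby yields decay at rate 1/N.
  N*P^N≤R : ∀ {φ} → (∀ B → P φ B ≤ φ B) → ∀ N B → fromℕ N * P^ N φ B ≤ R N φ B
  N*P^N≤R {φ} super zero    B = ≤-reflexive (*-zeroˡ (φ B))
  N*P^N≤R {φ} super (suc N) B = begin
    fromℕ (suc N) * P^ (suc N) φ B                     ≡⟨ cong (_* P^ (suc N) φ B) (fromℕ-suc N) ⟩
    (1ℚ + fromℕ N) * P^ (suc N) φ B                    ≡⟨ expand (fromℕ N) (P^ (suc N) φ B) ⟩
    P^ (suc N) φ B + fromℕ N * P^ (suc N) φ B          ≡⟨ cong (λ z → P^ (suc N) φ B + z) (P-*ˡ (fromℕ N) (P^ N φ) B) ⟨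
    P^ (suc N) φ B + P (λ C → fromℕ N * P^ N φ C) B    ≤⟨ +-mono-≤ (P^-superharmonic super (suc N) B) (P-mono (N*P^N≤R super N) B) ⟩
    φ B + P (R N φ) B                                  ∎
    where
    open ≤-Reasoning
    expand : ∀ n p → (1ℚ + n) * p ≡ p + n * p
    expand = solve-∀ ℚ-ring

module Duality {S T M : Set} (moves : List M) (w : ℚ) (0≤w : 0ℚ ≤ w)
  (actS : M → S → S) (actT : M → T → T) (χ : S → T → ℚ)
  (dual : ∀ μ σ B → χ (actS μ σ) B ≡ χ σ (actT μ B)) where

  open Average moves w 0≤w actT

  -- By `dual`, averaging over moves of the first argument of χ is the same as averaging over moves
  -- of the second. Operators on different arguments commute, so this passes to every power of `P`.
  R-dual : ∀ N σ B → w * ∑ moves (λ μ → R N (χ (actS μ σ)) B) ≡ P (R N (χ σ)) B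
  R-dual zero    σ B = refl
  R-dual (suc N) σ B = begin
    w * ∑ moves (λ μ → χ (actS μ σ) B + P (R N (χ (actS μ σ))) B)
      ≡⟨ cong (w *_) (ℚΣ.sum-∙ moves _ _) ⟩
    w * (∑ moves (λ μ → χ (actS μ σ) B) + ∑ moves (λ μ → P (R N (χ (actS μ σ))) B))
      ≡⟨ *-distribˡ-+ w _ _ ⟩
    w * ∑ moves (λ μ → χ (actS μ σ) B) + w * ∑ moves (λ μ → P (R N (χ (actS μ σ))) B)
      ≡⟨ cong₂ _+_ (cong (w *_) (ℚΣ.sum-cong moves λ μ → dual μ σ B)) commute ⟩
    P (χ σ) B + P (λ C → w * ∑ moves (λ μ → R N (χ (actS μ σ)) C)) B
      ≡⟨ cong (λ z → P (χ σ) B + z) (P-cong (R-dual N σ) B) ⟩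
    P (χ σ) B + P (P (R N (χ σ))) B
      ≡⟨ P-+ (χ σ) (P (R N (χ σ))) B ⟨
    P (R (suc N) (χ σ)) B ∎
    where
    open ≡-Reasoning
    commute : w * ∑ moves (λ μ → P (R N (χ (actS μ σ))) B) ≡
      P (λ C → w * ∑ moves (λ μ → R N (χ (actS μ σ)) C)) B
    commute = cong (w *_) (begin
      ∑ moves (λ μ → w * ∑ moves (λ ν → R N (χ (actS μ σ)) (actT ν B)))
        ≡⟨ ∑-*ˡ w moves _ ⟩
      w * ∑ moves (λ μ → ∑ moves (λ ν → R N (χ (actS μ σ)) (actT ν B)))
        ≡⟨ cong (w *_) (ℚΣ.sum-swap moves moves _) ⟩
      w * ∑ moves (λ ν → ∑ moves (λ μ → R N (χ (actS μ σ)) (actT ν B)))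
        ≡⟨ ∑-*ˡ w moves _ ⟨
      ∑ moves (λ ν → w * ∑ moves (λ μ → R N (χ (actS μ σ)) (actT ν B))) ∎)

  R-dual-telescope : ∀ N σ B →
    χ σ B + w * ∑ moves (λ μ → R N (χ (actS μ σ)) B) ≡ R N (χ σ) B + P^ N (χ σ) B
  R-dual-telescope N σ B = trans (cong (λ z → χ σ B + z) (R-dual N σ B)) (R-telescope N (χ σ) B)

-- Clauses as vertices, variables as edges, parities of violated clauses

module ⊕ = BigSum (CommutativeRing.+-commutativeMonoid Bool.xor-∧-commutativeRing)

module _ {A : Set} {P : Pred A 0ℓ} (P? : Decidable P) where

  filter-none : ∀ xs → length (filter P? xs) ≡ 0 → ∀ i → ¬ P (lookup xs i)
  filter-none (x ∷ xs) eq i Pi with P? x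
  filter-none (x ∷ xs) () i       Pi | yes Px
  filter-none (x ∷ xs) eq zero    Pi | no ¬Px = ¬Px Pi
  filter-none (x ∷ xs) eq (suc i) Pi | no ¬Px = filter-none xs eq i Pi

  filter-one : ∀ xs → length (filter P? xs) ≡ 1 →
    ∃ λ i → P (lookup xs i) × (∀ k → P (lookup xs k) → k ≡ i)
  filter-one (x ∷ xs) eq with P? x
  ... | yes Px = zero , Px , λ where
    zero    _  → refl
    (suc k) Pk → contradiction Pk (filter-none xs (ℕ.suc-injective eq) k)
  ... | no ¬Px with i , Pi , unique ← filter-one xs eq = suc i , Pi , λ where
    zero    Px → contradiction Px ¬Px
    (suc k) Pk → cong suc (unique k Pk)

  -- The witnesses are positions because the vertices of `T₃ Φ` are positions in the list of
  -- clauses.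
  filter-two : ∀ xs → length (filter P? xs) ≡ 2 →
    ∃₂ λ i j → i ≢ j × P (lookup xs i) × P (lookup xs j) × (∀ k → P (lookup xs k) → k ≡ i ⊎ k ≡ j)
  filter-two (x ∷ xs) eq with P? x
  ... | yes Px with j , Pj , unique ← filter-one xs (ℕ.suc-injective eq) =
    zero , suc j , (λ ()) , Px , Pj , λ where
      zero    _  → inj₁ refl
      (suc k) Pk → inj₂ (cong suc (unique k Pk))
  ... | no ¬Px with i , j , i≢j , Pi , Pj , unique ← filter-two xs eq =
    suc i , suc j , (λ { refl → i≢j refl }) , Pi , Pj , λ where
      zero    Px → contradiction Px ¬Px
      (suc k) Pk → Sum.map (cong suc) (cong suc) (unique k Pk)

module Incidence {n : ℕ} (Φ : Formula n) (regular : 2-Regular Φ) where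

  open import Data.List.Membership.DecPropositional (_≟_ {n}) using (_∈?_)

  m : ℕ
  m = length Φ

  clause : Fin m → Equation n
  clause = lookup Φ

  scope : Fin m → List (Fin n)
  scope i = vars (clause i)

  incident : Fin m → Fin n → Bool
  incident i v = does (v ∈? scope i)

  private
    ends : ∀ v → ∃₂ λ i j → i ≢ j × v ∈ scope i × v ∈ scope j × (∀ k → v ∈ scope k → k ≡ i ⊎ k ≡ j)
    ends v = filter-two (λ e → v ∈? vars e) Φ (regular v)

  -- The variable v is an edge of T₃(Φ) with endpoints end₁ v and end₂ v.
  end₁ end₂ : Fin n → Fin m
  end₁ v = proj₁ (ends v)
  end₂ v = proj₁ (proj₂ (ends v))

  end₁≢end₂ : ∀ v → end₁ v ≢ end₂ v
  end₁≢end₂ v = proj₁ (proj₂ (proj₂ (ends v)))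

  ∈end₁ : ∀ v → v ∈ scope (end₁ v)
  ∈end₁ v = proj₁ (proj₂ (proj₂ (proj₂ (ends v))))

  ∈end₂ : ∀ v → v ∈ scope (end₂ v)
  ∈end₂ v = proj₁ (proj₂ (proj₂ (proj₂ (proj₂ (ends v)))))

  ∈-ends : ∀ v k → v ∈ scope k → k ≡ end₁ v ⊎ k ≡ end₂ v
  ∈-ends v = proj₂ (proj₂ (proj₂ (proj₂ (proj₂ (ends v)))))

  -- A move crosses an edge of T₃(Φ) in one of its two directions.
  Move : Set
  Move = Fin n × Bool

  var : Move → Fin n
  var = proj₁

  src tgt : Move → Fin m
  src (v , o) = if o then end₁ v else end₂ v
  tgt (v , o) = if o then end₂ v else end₁ v

  moves : List Move
  moves = concatMap (λ v → (v , true) ∷ (v , false) ∷ []) (allFin n)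

  module Handshake (M : CommutativeMonoid 0ℓ 0ℓ) where
    open CommutativeMonoid M renaming (refl to ≈-refl; sym to ≈-sym; trans to ≈-trans)
    open import Relation.Binary.Reasoning.Setoid setoid
    open BigSum M

    sum-moves : (f : Move → Carrier) → sum moves f ≈ sum (allFin n) (λ v → f (v , true) ∙ f (v , false))
    sum-moves f = ≈-trans (sum-concatMap _ (allFin n) f)
      (sum-cong (allFin n) λ v → ∙-congˡ (identityʳ (f (v , false))))

    -- The three variables of an equation are distinct, so each incident variable is counted exactly
    -- once. In the xor monoid a repeated variable would cancel.
    sum-vars : ∀ e (f : Fin n → Carrier) → sum (vars e) f ≈ sum (allFin n) (λ v → does (v ∈? vars e) ▷ f v)
    sum-vars e f = begin
      f (x₁ e) ∙ (f (x₂ e) ∙ (f (x₃ e) ∙ ε))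
        ≈⟨ ∙-congˡ (∙-congˡ (identityʳ _)) ⟩
      f (x₁ e) ∙ (f (x₂ e) ∙ f (x₃ e))
        ≈⟨ ∙-cong (sum-δ (x₁ e) f) (∙-cong (sum-δ (x₂ e) f) (sum-δ (x₃ e) f)) ⟨
      sum (allFin n) (δ (x₁ e)) ∙ (sum (allFin n) (δ (x₂ e)) ∙ sum (allFin n) (δ (x₃ e)))
        ≈⟨ ∙-congˡ (sum-∙ (allFin n) _ _) ⟨
      sum (allFin n) (δ (x₁ e)) ∙ sum (allFin n) (λ v → δ (x₂ e) v ∙ δ (x₃ e) v)
        ≈⟨ sum-∙ (allFin n) _ _ ⟨
      sum (allFin n) (λ v → δ (x₁ e) v ∙ (δ (x₂ e) v ∙ δ (x₃ e) v))
        ≈⟨ sum-cong (allFin n) split ⟩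
      sum (allFin n) (λ v → does (v ∈? vars e) ▷ f v) ∎
      where
      δ : Fin n → Fin n → Carrier
      δ x v = does (v ≟ x) ▷ f v
      split : ∀ v → δ (x₁ e) v ∙ (δ (x₂ e) v ∙ δ (x₃ e) v) ≈ does (v ∈? vars e) ▷ f v
      split v with v ≟ x₁ e | v ≟ x₂ e | v ≟ x₃ e
      ... | yes p | yes q | _     = contradiction (trans (sym p) q) (x₁≢x₂ e)
      ... | yes p | no _  | yes q = contradiction (trans (sym p) q) (x₁≢x₃ e)
      ... | no _  | yes p | yes q = contradiction (trans (sym p) q) (x₂≢x₃ e)
      ... | yes p | no _  | no _  = ≈-trans (∙-congˡ (identityʳ ε)) (identityʳ _)
      ... | no _  | yes p | no _  = ≈-trans (identityˡ _) (identityʳ _)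
      ... | no _  | no _  | yes p = ≈-trans (identityˡ _) (identityˡ _)
      ... | no _  | no _  | no _  = ≈-trans (identityˡ _) (identityˡ _)

    sum-incident : ∀ v (f : Fin m → Carrier) → sum (allFin m) (λ i → incident i v ▷ f i) ≈ f (end₁ v) ∙ f (end₂ v)
    sum-incident v f = begin
      sum (allFin m) (λ i → incident i v ▷ f i)
        ≈⟨ sum-cong (allFin m) split ⟩
      sum (allFin m) (λ i → (does (i ≟ end₁ v) ▷ f i) ∙ (does (i ≟ end₂ v) ▷ f i))
        ≈⟨ sum-∙ (allFin m) _ _ ⟩
      sum (allFin m) (λ i → does (i ≟ end₁ v) ▷ f i) ∙ sum (allFin m) (λ i → does (i ≟ end₂ v) ▷ f i)
        ≈⟨ ∙-cong (sum-δ (end₁ v) f) (sum-δ (end₂ v) f) ⟩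
      f (end₁ v) ∙ f (end₂ v) ∎
      where
      split : ∀ i → incident i v ▷ f i ≈ (does (i ≟ end₁ v) ▷ f i) ∙ (does (i ≟ end₂ v) ▷ f i)
      split i with i ≟ end₁ v | i ≟ end₂ v
      ... | yes p    | yes q    = contradiction (trans (sym p) q) (end₁≢end₂ v)
      ... | yes refl | no _     rewrite dec-true (v ∈? scope i) (∈end₁ v) = ≈-sym (identityʳ _)
      ... | no _     | yes refl rewrite dec-true (v ∈? scope i) (∈end₂ v) = ≈-sym (identityˡ _)
      ... | no p     | no q     rewrite dec-false (v ∈? scope i) ([ p , q ]′ ∘ ∈-ends v i) = ≈-sym (identityʳ _)

    -- A pair of a clause and a variable in it is the start of exactly one move: the variable is the
    -- edge, and the clause tells the direction.
    sum-scopes : (f : Fin m → Fin n → Carrier) →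
      sum (allFin m) (λ i → sum (scope i) (f i)) ≈ sum moves (λ μ → f (src μ) (var μ))
    sum-scopes f = begin
      sum (allFin m) (λ i → sum (scope i) (f i))
        ≈⟨ sum-cong (allFin m) (λ i → sum-vars (clause i) (f i)) ⟩
      sum (allFin m) (λ i → sum (allFin n) (λ v → incident i v ▷ f i v))
        ≈⟨ sum-swap (allFin m) (allFin n) _ ⟩
      sum (allFin n) (λ v → sum (allFin m) (λ i → incident i v ▷ f i v))
        ≈⟨ sum-cong (allFin n) (λ v → sum-incident v (λ i → f i v)) ⟩
      sum (allFin n) (λ v → f (end₁ v) v ∙ f (end₂ v) v)
        ≈⟨ sum-moves _ ⟨
      sum moves (λ μ → f (src μ) (var μ)) ∎

  module H⊕ = Handshake (CommutativeRing.+-commutativeMonoid Bool.xor-∧-commutativeRing)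

  flip : Fin n → Assignment n → Assignment n
  flip v σ = updateAt σ v not

  unsat : Assignment n → Fin m → Bool
  unsat σ i = not (does (satisfies? σ (clause i)))

  lookup-flip : ∀ v σ x → Vec.lookup (flip v σ) x ≡ does (v ≟ x) xor Vec.lookup σ x
  lookup-flip v σ x with v ≟ x
  ... | yes refl = Vec.lookup∘updateAt v σ
  ... | no v≢x   = Vec.lookup∘updateAt′ x v (≢-sym v≢x) σ

  unsat-xor : ∀ σ i → unsat σ i ≡ rhs (clause i) xor ⊕.sum (scope i) (Vec.lookup σ)
  unsat-xor σ i = trans (not-≟ (Vec.lookup σ (x₁ (clause i)) xor (Vec.lookup σ (x₂ (clause i)) xor Vec.lookup σ (x₃ (clause i)))) (rhs (clause i)))
    (cong (λ z → rhs (clause i) xor (Vec.lookup σ (x₁ (clause i)) xor (Vec.lookup σ (x₂ (clause i)) xor z))) (sym (Bool.xor-identityʳ _)))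
    where
    not-≟ : ∀ b c → not (does (b Bool.≟ c)) ≡ c xor b
    not-≟ true  true  = refl
    not-≟ true  false = refl
    not-≟ false true  = refl
    not-≟ false false = refl

  unsat-flip : ∀ v σ i → unsat (flip v σ) i ≡ unsat σ i xor incident i v
  unsat-flip v σ i = begin
    unsat (flip v σ) i
      ≡⟨ unsat-xor (flip v σ) i ⟩
    rhs e xor ⊕.sum (scope i) (Vec.lookup (flip v σ))
      ≡⟨ cong (rhs e xor_) (trans (⊕.sum-cong (scope i) (lookup-flip v σ)) (⊕.sum-∙ (scope i) (λ x → does (v ≟ x)) (Vec.lookup σ))) ⟩
    rhs e xor (⊕.sum (scope i) (λ x → does (v ≟ x)) xor ⊕.sum (scope i) (Vec.lookup σ))
      ≡⟨ cong (λ z → rhs e xor (z xor ⊕.sum (scope i) (Vec.lookup σ))) count ⟩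
    rhs e xor (incident i v xor ⊕.sum (scope i) (Vec.lookup σ))
      ≡⟨ cong (rhs e xor_) (Bool.xor-comm (incident i v) _) ⟩
    rhs e xor (⊕.sum (scope i) (Vec.lookup σ) xor incident i v)
      ≡⟨ Bool.xor-assoc (rhs e) _ _ ⟨
    (rhs e xor ⊕.sum (scope i) (Vec.lookup σ)) xor incident i v
      ≡⟨ cong (_xor incident i v) (unsat-xor σ i) ⟨
    unsat σ i xor incident i v ∎
    where
    open ≡-Reasoning
    e = clause i
    count : ⊕.sum (scope i) (λ x → does (v ≟ x)) ≡ incident i v
    count with v ≟ x₁ e | v ≟ x₂ e | v ≟ x₃ e
    ... | yes p | yes q | _     = contradiction (trans (sym p) q) (x₁≢x₂ e)
    ... | yes p | no _  | yes q = contradiction (trans (sym p) q) (x₁≢x₃ e)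
    ... | no _  | yes p | yes q = contradiction (trans (sym p) q) (x₂≢x₃ e)
    ... | yes p | no _  | no _  = refl
    ... | no _  | yes p | no _  = refl
    ... | no _  | no _  | yes p = refl
    ... | no _  | no _  | no _  = refl

  -- The pairing, over the field with two elements, of `B` with the vector of violated clauses. A
  -- move adds u(src) · (e(src) + e(tgt)) to that vector u, which is linear in u; the transposed map
  -- overwrites the entry of `B` at the source by the one at the target.
  parity : Assignment n → Subset m → Bool
  parity σ B = ⊕.sum (allFin m) (λ i → Vec.lookup B i ∧ unsat σ i)

  parity-flip : ∀ v σ B → parity (flip v σ) B ≡ parity σ B xor (Vec.lookup B (end₁ v) xor Vec.lookup B (end₂ v))
  parity-flip v σ B = begin
    parity (flip v σ) B
      ≡⟨ ⊕.sum-cong (allFin m) (λ i → trans (cong (Vec.lookup B i ∧_) (unsat-flip v σ i)) (distrib (Vec.lookup B i) (unsat σ i) (incident i v))) ⟩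
    ⊕.sum (allFin m) (λ i → (Vec.lookup B i ∧ unsat σ i) xor (if incident i v then Vec.lookup B i else false))
      ≡⟨ ⊕.sum-∙ (allFin m) _ _ ⟩
    parity σ B xor ⊕.sum (allFin m) (λ i → if incident i v then Vec.lookup B i else false)
      ≡⟨ cong (parity σ B xor_) (H⊕.sum-incident v (Vec.lookup B)) ⟩
    parity σ B xor (Vec.lookup B (end₁ v) xor Vec.lookup B (end₂ v)) ∎
    where
    open ≡-Reasoning
    distrib : ∀ b u c → b ∧ (u xor c) ≡ (b ∧ u) xor (if c then b else false)
    distrib true  u     true  = refl
    distrib true  u     false = refl
    distrib false u     true  = refl
    distrib false u     false = refl

  adopt : Fin m → Fin m → Subset m → Subset m
  adopt i j B = B [ i ]≔ Vec.lookup B j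

  parity-adopt : ∀ i j σ B → parity σ (adopt i j B) ≡ parity σ B xor (unsat σ i ∧ (Vec.lookup B i xor Vec.lookup B j))
  parity-adopt i j σ B = begin
    parity σ (adopt i j B)
      ≡⟨ ⊕.sum-cong (allFin m) change ⟩
    ⊕.sum (allFin m) (λ k → (Vec.lookup B k ∧ unsat σ k) xor (if does (k ≟ i) then unsat σ k ∧ (Vec.lookup B k xor b) else false))
      ≡⟨ ⊕.sum-∙ (allFin m) _ _ ⟩
    parity σ B xor ⊕.sum (allFin m) (λ k → if does (k ≟ i) then unsat σ k ∧ (Vec.lookup B k xor b) else false)
      ≡⟨ cong (parity σ B xor_) (⊕.sum-δ i (λ k → unsat σ k ∧ (Vec.lookup B k xor b))) ⟩
    parity σ B xor (unsat σ i ∧ (Vec.lookup B i xor b)) ∎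
    where
    open ≡-Reasoning
    b = Vec.lookup B j
    replace : ∀ b c u → c ∧ u ≡ (b ∧ u) xor (u ∧ (b xor c))
    replace true  true  true  = refl
    replace true  true  false = refl
    replace true  false true  = refl
    replace true  false false = refl
    replace false true  true  = refl
    replace false true  false = refl
    replace false false true  = refl
    replace false false false = refl
    change : ∀ k → Vec.lookup (adopt i j B) k ∧ unsat σ k ≡
      (Vec.lookup B k ∧ unsat σ k) xor (if does (k ≟ i) then unsat σ k ∧ (Vec.lookup B k xor b) else false)
    change k with k ≟ i
    ... | yes refl = trans (cong (_∧ unsat σ k) (Vec.lookup∘updateAt k B)) (replace (Vec.lookup B k) b (unsat σ k))
    ... | no k≢i   = trans (cong (_∧ unsat σ k) (Vec.lookup∘updateAt′ k i k≢i B)) (sym (Bool.xor-identityʳ _))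

  step : Move → Assignment n → Assignment n
  step μ σ = if unsat σ (src μ) then flip (var μ) σ else σ

  copy : Move → Subset m → Subset m
  copy μ = adopt (src μ) (tgt μ)

  -- On the left violated clauses walk along T₃(Φ) and annihilate in pairs; on the right src μ
  -- adopts the opinion of tgt μ, as in the voter model.
  parity-dual : ∀ μ σ B → parity (step μ σ) B ≡ parity σ (copy μ B)
  parity-dual μ σ B = trans (walk (unsat σ (src μ)) refl) (sym (parity-adopt (src μ) (tgt μ) σ B))
    where
    orient : ∀ μ → Vec.lookup B (end₁ (var μ)) xor Vec.lookup B (end₂ (var μ)) ≡ Vec.lookup B (src μ) xor Vec.lookup B (tgt μ)
    orient (v , true)  = refl
    orient (v , false) = Bool.xor-comm (Vec.lookup B (end₁ v)) _
    walk : ∀ u → u ≡ unsat σ (src μ) → parity (if u then flip (var μ) σ else σ) B ≡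
      parity σ B xor (u ∧ (Vec.lookup B (src μ) xor Vec.lookup B (tgt μ)))
    walk true  _ = trans (parity-flip (var μ) σ B) (cong (parity σ B xor_) (orient μ))
    walk false _ = sym (Bool.xor-identityʳ _)

  parity-⊥ : ∀ σ → parity σ ⊥ ≡ false
  parity-⊥ σ = trans (⊕.sum-cong (allFin m) λ i → cong (_∧ unsat σ i) (Vec.lookup-replicate i false)) (⊕.sum-ε (allFin m))

  -- Summing all equations cancels every variable, as each occurs twice. What remains is the sum of
  -- the right-hand sides, which does not depend on the assignment and vanishes for a satisfying
  -- one.
  parity-⊤ : Satisfiable Φ → ∀ σ → parity σ ⊤ ≡ false
  parity-⊤ (σ₀ , sat) σ = begin
    parity σ ⊤                                 ≡⟨ parity-rhs σ ⟩
    ⊕.sum (allFin m) (rhs ∘ clause)            ≡⟨ parity-rhs σ₀ ⟨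
    parity σ₀ ⊤                                ≡⟨ ⊕.sum-cong (allFin m) (λ i → trans (cong (Vec.lookup ⊤ i ∧_) (satisfied i)) (Bool.∧-zeroʳ (Vec.lookup ⊤ i))) ⟩
    ⊕.sum (allFin m) (λ _ → false)             ≡⟨ ⊕.sum-ε (allFin m) ⟩
    false                                      ∎
    where
    open ≡-Reasoning
    satisfied : ∀ i → unsat σ₀ i ≡ false
    satisfied i = cong not (dec-true (satisfies? σ₀ (clause i)) (All.lookup sat (∈-lookup i)))
    parity-rhs : ∀ σ → parity σ ⊤ ≡ ⊕.sum (allFin m) (rhs ∘ clause)
    parity-rhs σ = begin
      parity σ ⊤
        ≡⟨ ⊕.sum-cong (allFin m) (λ i → trans (cong (_∧ unsat σ i) (Vec.lookup-replicate i true)) (unsat-xor σ i)) ⟩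
      ⊕.sum (allFin m) (λ i → rhs (clause i) xor ⊕.sum (scope i) (Vec.lookup σ))
        ≡⟨ ⊕.sum-∙ (allFin m) _ _ ⟩
      ⊕.sum (allFin m) (rhs ∘ clause) xor ⊕.sum (allFin m) (λ i → ⊕.sum (scope i) (Vec.lookup σ))
        ≡⟨ cong (⊕.sum (allFin m) (rhs ∘ clause) xor_) (trans (H⊕.sum-scopes (λ _ → Vec.lookup σ)) (H⊕.sum-moves _)) ⟩
      ⊕.sum (allFin m) (rhs ∘ clause) xor ⊕.sum (allFin n) (λ v → Vec.lookup σ v xor Vec.lookup σ v)
        ≡⟨ cong (⊕.sum (allFin m) (rhs ∘ clause) xor_) (trans (⊕.sum-cong (allFin n) (λ v → Bool.xor-same (Vec.lookup σ v))) (⊕.sum-ε (allFin n))) ⟩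
      ⊕.sum (allFin m) (rhs ∘ clause) xor false
        ≡⟨ Bool.xor-identityʳ _ ⟩
      ⊕.sum (allFin m) (rhs ∘ clause) ∎

-- Indicators, sizes of subsets, expectations

ι : Bool → ℚ
ι b = if b then 1ℚ else 0ℚ

0≤ι : ∀ b → 0ℚ ≤ ι b
0≤ι true  = 0≤fromℕ 1
0≤ι false = ≤-refl

ι≤1 : ∀ b → ι b ≤ 1ℚ
ι≤1 true  = ≤-refl
ι≤1 false = 0≤fromℕ 1

0≤square : ∀ x → 0ℚ ≤ x * x
0≤square x with ≤-total 0ℚ x
... | inj₁ 0≤x = 0≤* 0≤x 0≤x
... | inj₂ x≤0 = subst (0ℚ ≤_) (neg² x) (0≤* 0≤-x 0≤-x)
  where
  0≤-x : 0ℚ ≤ - x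
  0≤-x = neg-antimono-≤ x≤0
  neg² : ∀ x → (- x) * (- x) ≡ x * x
  neg² = solve-∀ ℚ-ring

∑-indicator : ∀ {k} (B : Subset k) → ∑ (allFin k) (ι ∘ Vec.lookup B) ≡ fromℕ ∣ B ∣
∑-indicator []          = refl
∑-indicator (true ∷ B)  = trans (ℚΣ.sum-allFin-suc (ι ∘ Vec.lookup (true ∷ B)))
  (trans (cong (λ z → 1ℚ + z) (∑-indicator B)) (sym (fromℕ-suc ∣ B ∣)))
∑-indicator (false ∷ B) = trans (ℚΣ.sum-allFin-suc (ι ∘ Vec.lookup (false ∷ B)))
  (trans (+-identityˡ _) (∑-indicator B))

lookup-⁅⁆ : ∀ {k} (x i : Fin k) → Vec.lookup ⁅ x ⁆ i ≡ does (i ≟ x)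
lookup-⁅⁆ zero    zero    = refl
lookup-⁅⁆ zero    (suc i) = Vec.lookup-replicate i false
lookup-⁅⁆ (suc x) zero    = refl
lookup-⁅⁆ (suc x) (suc i) = lookup-⁅⁆ x i

empty-full-proper : ∀ {k} (B : Subset k) → B ≡ ⊥ ⊎ B ≡ ⊤ ⊎ (0 ℕ.< ∣ B ∣ × ∣ B ∣ ℕ.< k)
empty-full-proper {k} B with Subset.nonempty? B | ∣ B ∣ ℕ.≟ k
... | no empty      | _      = inj₁ (Subset.Empty-unique empty)
... | yes (x , x∈B) | yes eq = inj₂ (inj₁ (Subset.∣p∣≡n⇒p≡⊤ eq))
... | yes (x , x∈B) | no neq = inj₂ (inj₂ (ℕ.≤-trans (ℕ.s≤s ℕ.z≤n) (Subset.x∈p⇒∣p-x∣<∣p∣ x∈B) , ℕ.≤∧≢⇒< (Subset.∣p∣≤n B) neq))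

𝔼-return : {A : Set} (a : A) (f : A → ℚ) → 𝔼 (return a) f ≡ f a
𝔼-return a f = trans (+-identityʳ _) (*-identityˡ (f a))

𝔼-uniform : {A : Set} (xs : List A) (f : A → ℚ) → 𝔼 (uniform xs) f ≡ recip (length xs) * ∑ xs f
𝔼-uniform xs f = trans (ℚΣ.sum-map _ xs _) (∑-*ˡ (recip (length xs)) xs f)

𝔼->>= : {A B : Set} (d : Dist A) (k : A → Dist B) (f : B → ℚ) → 𝔼 (d >>= k) f ≡ 𝔼 d (λ a → 𝔼 (k a) f)
𝔼->>= d k f = trans (ℚΣ.sum-concatMap _ d _) (ℚΣ.sum-cong d λ (w , a) → begin
  ∑ (map (λ (w′ , b) → w * w′ , b) (k a)) (λ (w , b) → w * f b) ≡⟨ ℚΣ.sum-map _ (k a) _ ⟩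
  ∑ (k a) (λ (w′ , b) → w * w′ * f b)                           ≡⟨ ℚΣ.sum-cong (k a) (λ (w′ , b) → *-assoc w w′ (f b)) ⟩
  ∑ (k a) (λ (w′ , b) → w * (w′ * f b))                         ≡⟨ ∑-*ˡ w (k a) _ ⟩
  w * 𝔼 (k a) f                                                 ∎)
  where open ≡-Reasoning

𝔼-cong : {A : Set} (d : Dist A) {f g : A → ℚ} → (∀ a → f a ≡ g a) → 𝔼 d f ≡ 𝔼 d g
𝔼-cong d f≡g = ℚΣ.sum-cong d λ (w , a) → cong (w *_) (f≡g a)

-- The potential of the voter model and the drift of RandomWalkSat

module Walk {n : ℕ} (Φ : Formula n) (regular : 2-Regular Φ) (satisfiable : Satisfiable Φ) (0<m : 0 ℕ.< length Φ) where

  open Incidence Φ regular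
  module Hℚ = Handshake +-0-commutativeMonoid

  -- There are 3m moves, three for each clause, so that with weight `w` the operator `P` is a
  -- probability average.
  M 3M w : ℚ
  M = fromℕ m
  3M = M * fromℕ 3
  w = recip (m ℕ.* 3)

  0≤M : 0ℚ ≤ M
  0≤M = 0≤fromℕ m

  1≤M : 1ℚ ≤ M
  1≤M = fromℕ-mono-≤ {1} {m} 0<m

  w*3M≡1 : w * 3M ≡ 1ℚ
  w*3M≡1 = trans (cong (w *_) (sym (fromℕ-* m 3))) (inverse 0<m)
    where
    inverse : ∀ {k} → 0 ℕ.< k → recip (k ℕ.* 3) * fromℕ (k ℕ.* 3) ≡ 1ℚ
    inverse {suc k} _ = recip-inverse (2 ℕ.+ k ℕ.* 3)

  ∑-moves-const : ∀ c → ∑ moves (λ _ → c) ≡ 3M * c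
  ∑-moves-const c = begin
    ∑ moves (λ _ → c)                              ≡⟨ Hℚ.sum-scopes (λ _ _ → c) ⟨
    ∑ (allFin m) (λ i → c + (c + (c + 0ℚ)))        ≡⟨ ∑-const (c + (c + (c + 0ℚ))) (allFin m) ⟩
    fromℕ (length (allFin m)) * (c + (c + (c + 0ℚ))) ≡⟨ cong (λ k → fromℕ k * (c + (c + (c + 0ℚ)))) (List.length-tabulate {n = m} (λ i → i)) ⟩
    M * (c + (c + (c + 0ℚ)))                       ≡⟨ triple M c ⟩
    3M * c                                         ∎
    where
    open ≡-Reasoning
    triple : ∀ M c → M * (c + (c + (c + 0ℚ))) ≡ M * (1ℚ + 1ℚ + 1ℚ) * c
    triple = solve-∀ ℚ-ring

  card : Subset m → ℚ
  card B = ∑ (allFin m) (ι ∘ Vec.lookup B)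

  ψ : Subset m → ℚ
  ψ B = card B * (M - card B)

  d : Subset m → Move → ℚ
  d B μ = ι (Vec.lookup B (tgt μ)) - ι (Vec.lookup B (src μ))

  -- Each variable crossing between B and its complement is counted in both directions.
  D : Subset m → ℚ
  D B = ∑ moves (λ μ → d B μ * d B μ)

  0≤D : ∀ B → 0ℚ ≤ D B
  0≤D B = 0≤∑ moves λ μ → 0≤square (d B μ)

  card-copy : ∀ μ B → card (copy μ B) ≡ card B + d B μ
  card-copy μ B = begin
    card (copy μ B)
      ≡⟨ ℚΣ.sum-cong (allFin m) change ⟩
    ∑ (allFin m) (λ k → ι (Vec.lookup B k) + (if does (k ≟ src μ) then ι (Vec.lookup B (tgt μ)) - ι (Vec.lookup B k) else 0ℚ))
      ≡⟨ ℚΣ.sum-∙ (allFin m) _ _ ⟩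
    card B + ∑ (allFin m) (λ k → if does (k ≟ src μ) then ι (Vec.lookup B (tgt μ)) - ι (Vec.lookup B k) else 0ℚ)
      ≡⟨ cong (λ z → card B + z) (ℚΣ.sum-δ (src μ) (λ k → ι (Vec.lookup B (tgt μ)) - ι (Vec.lookup B k))) ⟩
    card B + d B μ ∎
    where
    open ≡-Reasoning
    replace : ∀ x y → y ≡ x + (y - x)
    replace = solve-∀ ℚ-ring
    change : ∀ k → ι (Vec.lookup (copy μ B) k) ≡
      ι (Vec.lookup B k) + (if does (k ≟ src μ) then ι (Vec.lookup B (tgt μ)) - ι (Vec.lookup B k) else 0ℚ)
    change k with k ≟ src μ
    ... | yes refl = trans (cong ι (Vec.lookup∘updateAt k B)) (replace (ι (Vec.lookup B k)) _)
    ... | no k≢i   = trans (cong ι (Vec.lookup∘updateAt′ k (src μ) k≢i B)) (sym (+-identityʳ _))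

  ∑-d : ∀ B → ∑ moves (d B) ≡ 0ℚ
  ∑-d B = trans (Hℚ.sum-moves (d B)) (trans (ℚΣ.sum-cong (allFin n) λ v → cancel (ι (Vec.lookup B (end₂ v))) (ι (Vec.lookup B (end₁ v)))) (ℚΣ.sum-ε (allFin n)))
    where
    cancel : ∀ x y → x - y + (y - x) ≡ 0ℚ
    cancel = solve-∀ ℚ-ring

  0≤w : 0ℚ ≤ w
  0≤w = 0≤recip (m ℕ.* 3)

  χ : Assignment n → Subset m → ℚ
  χ σ B = ι (parity σ B)

  open Average moves w 0≤w copy
  open Duality moves w 0≤w step copy χ (λ μ σ B → cong ι (parity-dual μ σ B))

  -- The size of `B` is a martingale: the two directions of each variable change it by opposite
  -- amounts (`∑-d`). Of the quadratic `ψ` only the squared increments survive the averaging.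
  P-ψ : ∀ B → P ψ B ≡ ψ B - w * D B
  P-ψ B = begin
    w * ∑ moves (λ μ → ψ (copy μ B))
      ≡⟨ cong (w *_) (ℚΣ.sum-cong moves λ μ → trans (cong (λ k → k * (M - k)) (card-copy μ B)) (expand (card B) M (d B μ))) ⟩
    w * ∑ moves (λ μ → ψ B + ((M - (card B + card B)) * d B μ + - 1ℚ * (d B μ * d B μ)))
      ≡⟨ cong (w *_) (trans (ℚΣ.sum-∙ moves _ _) (cong₂ _+_ (∑-moves-const (ψ B)) (ℚΣ.sum-∙ moves _ _))) ⟩
    w * (3M * ψ B + (∑ moves (λ μ → (M - (card B + card B)) * d B μ) + ∑ moves (λ μ → - 1ℚ * (d B μ * d B μ))))
      ≡⟨ cong₂ (λ y z → w * (3M * ψ B + (y + z))) (trans (∑-*ˡ (M - (card B + card B)) moves (d B)) (cong ((M - (card B + card B)) *_) (∑-d B))) (∑-*ˡ (- 1ℚ) moves _) ⟩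
    w * (3M * ψ B + ((M - (card B + card B)) * 0ℚ + - 1ℚ * D B))
      ≡⟨ collect w 3M (ψ B) (M - (card B + card B)) (D B) ⟩
    w * 3M * ψ B - w * D B
      ≡⟨ cong (λ z → z * ψ B - w * D B) w*3M≡1 ⟩
    1ℚ * ψ B - w * D B
      ≡⟨ cong (_- w * D B) (*-identityˡ (ψ B)) ⟩
    ψ B - w * D B ∎
    where
    open ≡-Reasoning
    expand : ∀ K M d → (K + d) * (M - (K + d)) ≡ K * (M - K) + ((M - (K + K)) * d + - 1ℚ * (d * d))
    expand = solve-∀ ℚ-ring
    collect : ∀ w L p q D → w * (L * p + (q * 0ℚ + - 1ℚ * D)) ≡ w * L * p - w * D
    collect = solve-∀ ℚ-ring

  card≡∣∣ : ∀ B → card B ≡ fromℕ ∣ B ∣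
  card≡∣∣ = ∑-indicator

  ψ-⊥ : ψ ⊥ ≡ 0ℚ
  ψ-⊥ = trans (cong (λ k → k * (M - k)) (trans (card≡∣∣ ⊥) (cong fromℕ (Subset.∣⊥∣≡0 m)))) (*-zeroˡ (M - 0ℚ))

  ψ-⊤ : ψ ⊤ ≡ 0ℚ
  ψ-⊤ = trans (cong (λ k → k * (M - k)) (trans (card≡∣∣ ⊤) (cong fromℕ (Subset.∣⊤∣≡n m)))) (vanish M)
    where
    vanish : ∀ M → M * (M - M) ≡ 0ℚ
    vanish = solve-∀ ℚ-ring

  ψ-⁅⁆ : ∀ x → ψ ⁅ x ⁆ ≡ M - 1ℚ
  ψ-⁅⁆ x = trans (cong (λ k → k * (M - k)) (trans (card≡∣∣ ⁅ x ⁆) (cong fromℕ (Subset.∣⁅x⁆∣≡1 x)))) (*-identityˡ (M - 1ℚ))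

  1≤card : ∀ B → 0 ℕ.< ∣ B ∣ → 1ℚ ≤ card B
  1≤card B 0<k = subst (1ℚ ≤_) (sym (card≡∣∣ B)) (fromℕ-mono-≤ {1} {∣ B ∣} 0<k)

  1+card≤M : ∀ B → ∣ B ∣ ℕ.< m → 1ℚ + card B ≤ M
  1+card≤M B k<m = subst (_≤ M) (trans (fromℕ-suc ∣ B ∣) (cong (λ z → 1ℚ + z) (sym (card≡∣∣ B)))) (fromℕ-mono-≤ {suc ∣ B ∣} {m} k<m)

  M-1≤ψ : ∀ B → 0 ℕ.< ∣ B ∣ → ∣ B ∣ ℕ.< m → M - 1ℚ ≤ ψ B
  M-1≤ψ B 0<k k<m = diff (0≤* (p≤q⇒0≤q-p (1≤card B 0<k)) (p≤q⇒0≤q-p (1+card≤M B k<m))) (split (card B) M)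
    where
    split : ∀ K M → K * (M - K) ≡ M - 1ℚ + (K - 1ℚ) * (M - (1ℚ + K))
    split = solve-∀ ℚ-ring

  1≤ψ : ∀ B → 0 ℕ.< ∣ B ∣ → ∣ B ∣ ℕ.< m → 1ℚ ≤ ψ B
  1≤ψ B 0<k k<m = ≤-trans (diff (0≤+ (p≤q⇒0≤q-p (1≤card B 0<k)) (p≤q⇒0≤q-p (1+card≤M B k<m))) (split (card B) M)) (M-1≤ψ B 0<k k<m)
    where
    split : ∀ K M → M - 1ℚ ≡ 1ℚ + (K - 1ℚ + (M - (1ℚ + K)))
    split = solve-∀ ℚ-ring

  card≤M : ∀ B → card B ≤ M
  card≤M B = subst (_≤ M) (sym (card≡∣∣ B)) (fromℕ-mono-≤ {∣ B ∣} {m} (Subset.∣p∣≤n B))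

  0≤card : ∀ B → 0ℚ ≤ card B
  0≤card B = 0≤∑ (allFin m) (0≤ι ∘ Vec.lookup B)

  0≤ψ : ∀ B → 0ℚ ≤ ψ B
  0≤ψ B = 0≤* (0≤card B) (p≤q⇒0≤q-p (card≤M B))

  ψ≤M² : ∀ B → ψ B ≤ M * M
  ψ≤M² B = diff (0≤+ (0≤* (p≤q⇒0≤q-p (card≤M B)) 0≤M) (0≤square (card B))) (split (card B) M)
    where
    split : ∀ K M → M * M ≡ K * (M - K) + ((M - K) * M + K * K)
    split = solve-∀ ℚ-ring

  P-ψ≤ψ : ∀ B → P ψ B ≤ ψ B
  P-ψ≤ψ B = diff (0≤* 0≤w (0≤D B)) (trans (restore (ψ B) (w * D B)) (cong (_+ w * D B) (sym (P-ψ B))))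
    where
    restore : ∀ p x → p ≡ p - x + x
    restore = solve-∀ ℚ-ring

  -- Since `ψ` loses w · D on average and w · 3m = 1, the function c · 3m · ψ loses exactly c · D,
  -- hence at least γ · h. The bound is uniform in N; keeping γ on the left avoids a division.
  R-bound : ∀ γ c h → (∀ B → γ * h B ≤ c * D B) → 0ℚ ≤ c → ∀ N B → γ * R N h B ≤ c * 3M * ψ B
  R-bound γ c h h≤D 0≤c N B = ≤-trans (p≤p+q (0≤P^ N 0≤φ B)) (potential-bound γ h φ super N B)
    where
    φ : Subset m → ℚ
    φ B = c * 3M * ψ B
    0≤φ : ∀ B → 0ℚ ≤ φ B
    0≤φ B = 0≤* (0≤* 0≤c (0≤* 0≤M (0≤fromℕ 3))) (0≤ψ B)
    cancel : ∀ c D L w p → c * D + c * L * (p - w * D) ≡ c * L * p + c * D * (1ℚ - w * L)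
    cancel = solve-∀ ℚ-ring
    vanish : ∀ x y → x + y * (1ℚ - 1ℚ) ≡ x
    vanish = solve-∀ ℚ-ring
    super : ∀ B → γ * h B + P φ B ≤ φ B
    super B = begin
      γ * h B + P φ B                             ≤⟨ +-monoˡ-≤ (P φ B) (h≤D B) ⟩
      c * D B + P φ B                             ≡⟨ cong (λ z → c * D B + z) (trans (P-*ˡ (c * 3M) ψ B) (cong (c * 3M *_) (P-ψ B))) ⟩
      c * D B + c * 3M * (ψ B - w * D B)          ≡⟨ cancel c (D B) 3M w (ψ B) ⟩
      c * 3M * ψ B + c * D B * (1ℚ - w * 3M)      ≡⟨ cong (λ z → c * 3M * ψ B + c * D B * (1ℚ - z)) w*3M≡1 ⟩
      c * 3M * ψ B + c * D B * (1ℚ - 1ℚ)          ≡⟨ vanish (c * 3M * ψ B) (c * D B) ⟩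
      φ B                                         ∎
      where open ≤-Reasoning

  starts : List (Fin m)
  starts = allFin m

  -- The tail is measured with `ψ` in place of the parity: this dominates it for every assignment at
  -- once, and `ψ` is superharmonic, so `N*P^N≤R` applies.
  ε : ℕ → ℚ
  ε N = ∑ starts (λ x → P^ N ψ ⁅ x ⁆)

  0≤ε : ∀ N → 0ℚ ≤ ε N
  0≤ε N = 0≤∑ starts λ x → 0≤P^ N 0≤ψ ⁅ x ⁆

  -- As N → ∞ this tends to m times the expected running time; ε N bounds the truncation error.
  G : ℕ → Assignment n → ℚ
  G N σ = ∑ starts (λ x → R N (χ σ) ⁅ x ⁆)

  0≤G : ∀ N σ → 0ℚ ≤ G N σ
  0≤G N σ = 0≤∑ starts λ x → 0≤R N (0≤ι ∘ parity σ) ⁅ x ⁆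

  -- The parity vanishes at both zeros of `ψ`, the empty and the full set; at every other set `ψ` is
  -- at least 1.
  χ≤ψ : ∀ σ B → χ σ B ≤ ψ B
  χ≤ψ σ B with empty-full-proper B
  ... | inj₁ refl        = ≤-reflexive (trans (cong ι (parity-⊥ σ)) (sym ψ-⊥))
  ... | inj₂ (inj₁ refl) = ≤-reflexive (trans (cong ι (parity-⊤ satisfiable σ)) (sym ψ-⊤))
  ... | inj₂ (inj₂ (0<k , k<m)) = ≤-trans (ι≤1 (parity σ B)) (1≤ψ B 0<k k<m)

  ∑-starts : ∀ c → ∑ starts (λ _ → c) ≡ M * c
  ∑-starts c = trans (∑-const c starts) (cong (λ k → fromℕ k * c) (List.length-tabulate {n = m} (λ i → i)))

  #unsat : Assignment n → ℚ
  #unsat σ = fromℕ (length (unsatisfied Φ σ))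

  ∑-unsatisfied : ∀ σ (f : Equation n → ℚ) → ∑ (unsatisfied Φ σ) f ≡ ∑ (allFin m) (λ i → if unsat σ i then f (clause i) else 0ℚ)
  ∑-unsatisfied σ f = trans (ℚΣ.sum-filter (λ e → ¬? (satisfies? σ e)) Φ f) (ℚΣ.sum-lookup Φ _)

  #unsat≡ : ∀ σ c → #unsat σ * c ≡ ∑ (allFin m) (λ i → if unsat σ i then c else 0ℚ)
  #unsat≡ σ c = trans (sym (∑-const c (unsatisfied Φ σ))) (∑-unsatisfied σ (λ _ → c))

  -- This is why the potential is summed over all singletons: the first terms of the series, which
  -- are lost in one lazy step, add up to the number of violated clauses.
  ∑-χ-⁅⁆ : ∀ σ → ∑ starts (λ x → χ σ ⁅ x ⁆) ≡ #unsat σ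
  ∑-χ-⁅⁆ σ = trans (ℚΣ.sum-cong starts λ x → cong ι (singleton x)) (trans (sym (#unsat≡ σ 1ℚ)) (*-identityʳ _))
    where
    ∧-if : ∀ b c → b ∧ c ≡ (if b then c else false)
    ∧-if true  c = refl
    ∧-if false c = refl
    singleton : ∀ x → parity σ ⁅ x ⁆ ≡ unsat σ x
    singleton x = trans (⊕.sum-cong (allFin m) λ i → trans (cong (_∧ unsat σ i) (lookup-⁅⁆ x i)) (∧-if (does (i ≟ x)) _))
      (⊕.sum-δ x (unsat σ))

  ∑-flips : (Assignment n → ℚ) → Assignment n → ℚ
  ∑-flips g σ = ∑ (unsatisfied Φ σ) (λ e → ∑ (vars e) (λ v → g (flip v σ)))

  -- Moves at satisfied clauses leave σ in place. Adding 3 · g σ for each violated clause on the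
  -- left, and for every clause on the right, accounts for them without a subtraction.
  ∑-step : ∀ g σ → ∑ moves (λ μ → g (step μ σ)) + #unsat σ * (fromℕ 3 * g σ) ≡ ∑-flips g σ + 3M * g σ
  ∑-step g σ = begin
    ∑ moves (λ μ → g (step μ σ)) + #unsat σ * (fromℕ 3 * g σ)
      ≡⟨ cong₂ _+_ (sym (Hℚ.sum-scopes (λ i v → g (if unsat σ i then flip v σ else σ)))) (#unsat≡ σ (fromℕ 3 * g σ)) ⟩
    ∑ (allFin m) (λ i → ∑ (scope i) (λ v → g (if unsat σ i then flip v σ else σ))) + ∑ (allFin m) (λ i → if unsat σ i then fromℕ 3 * g σ else 0ℚ)
      ≡⟨ ℚΣ.sum-∙ (allFin m) _ _ ⟨
    ∑ (allFin m) (λ i → ∑ (scope i) (λ v → g (if unsat σ i then flip v σ else σ)) + (if unsat σ i then fromℕ 3 * g σ else 0ℚ))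
      ≡⟨ ℚΣ.sum-cong (allFin m) (λ i → exchange (unsat σ i) i) ⟩
    ∑ (allFin m) (λ i → (if unsat σ i then ∑ (scope i) (λ v → g (flip v σ)) else 0ℚ) + fromℕ 3 * g σ)
      ≡⟨ ℚΣ.sum-∙ (allFin m) _ _ ⟩
    ∑ (allFin m) (λ i → if unsat σ i then ∑ (scope i) (λ v → g (flip v σ)) else 0ℚ) + ∑ (allFin m) (λ _ → fromℕ 3 * g σ)
      ≡⟨ cong₂ _+_ (sym (∑-unsatisfied σ _)) (trans (∑-starts (fromℕ 3 * g σ)) (sym (*-assoc M (fromℕ 3) (g σ)))) ⟩
    ∑-flips g σ + 3M * g σ ∎
    where
    open ≡-Reasoning
    triple : ∀ x → x + (x + (x + 0ℚ)) + 0ℚ ≡ 0ℚ + (1ℚ + 1ℚ + 1ℚ) * x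
    triple = solve-∀ ℚ-ring
    exchange : ∀ b i → ∑ (scope i) (λ v → g (if b then flip v σ else σ)) + (if b then fromℕ 3 * g σ else 0ℚ) ≡
      (if b then ∑ (scope i) (λ v → g (flip v σ)) else 0ℚ) + fromℕ 3 * g σ
    exchange true  i = refl
    exchange false i = triple (g σ)

  G-step : ∀ N σ → #unsat σ + w * ∑ moves (λ μ → G N (step μ σ)) ≤ G N σ + ε N
  G-step N σ = begin
    #unsat σ + w * ∑ moves (λ μ → G N (step μ σ))
      ≡⟨ cong₂ _+_ (sym (∑-χ-⁅⁆ σ)) (trans (cong (w *_) (ℚΣ.sum-swap moves starts _)) (sym (∑-*ˡ w starts _))) ⟩
    ∑ starts (λ x → χ σ ⁅ x ⁆) + ∑ starts (λ x → w * ∑ moves (λ μ → R N (χ (step μ σ)) ⁅ x ⁆))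
      ≡⟨ ℚΣ.sum-∙ starts _ _ ⟨
    ∑ starts (λ x → χ σ ⁅ x ⁆ + w * ∑ moves (λ μ → R N (χ (step μ σ)) ⁅ x ⁆))
      ≡⟨ ℚΣ.sum-cong starts (λ x → R-dual-telescope N σ ⁅ x ⁆) ⟩
    ∑ starts (λ x → R N (χ σ) ⁅ x ⁆ + P^ N (χ σ) ⁅ x ⁆)
      ≡⟨ ℚΣ.sum-∙ starts _ _ ⟩
    G N σ + ∑ starts (λ x → P^ N (χ σ) ⁅ x ⁆)
      ≤⟨ +-monoʳ-≤ (G N σ) (∑-mono starts λ x → P^-mono N (χ≤ψ σ) ⁅ x ⁆) ⟩
    G N σ + ε N ∎
    where open ≤-Reasoning

  κ : ℕ → ℚ
  κ N = M - M * ε N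

  -- Without idling the average is over 3u moves in place of 3m, where u is the number of violated
  -- clauses. The drop u of `G-step` thus becomes m, and the error `ε N` becomes m/u times itself,
  -- at most m · `ε N` because u ≥ 1. The difference is `κ N`.
  drift : ∀ N σ {k} → length (unsatisfied Φ σ) ≡ suc k →
    κ N + recip (suc k) * (recip 3 * ∑-flips (G N) σ) ≤ G N σ
  drift N σ {k} eq = begin
    κ N + ρ * (recip 3 * S)
      ≡⟨ cong (λ z → z + ρ * (recip 3 * S)) (trans (sym (*-identityˡ (κ N))) (cong (_* κ N) (sym 1≡))) ⟩
    ρ * u * (recip 3 * fromℕ 3) * κ N + ρ * (recip 3 * S)
      ≡⟨ factor ρ u (recip 3) (fromℕ 3) (κ N) S ⟩
    ρ * recip 3 * (u * fromℕ 3 * κ N + S)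
      ≤⟨ *ˡ-mono (0≤* (0≤recip (suc k)) (0≤recip 3)) main ⟩
    ρ * recip 3 * (u * fromℕ 3 * g)
      ≡⟨ unfactor ρ u (recip 3) (fromℕ 3) g ⟩
    ρ * u * (recip 3 * fromℕ 3) * g
      ≡⟨ trans (cong (_* g) 1≡) (*-identityˡ g) ⟩
    g ∎
    where
    open ≤-Reasoning
    u ρ g S X : ℚ
    u = fromℕ (suc k)
    ρ = recip (suc k)
    g = G N σ
    S = ∑-flips (G N) σ
    X = ∑ moves (λ μ → G N (step μ σ))
    1≡ : ρ * u * (recip 3 * fromℕ 3) ≡ 1ℚ
    1≡ = cong₂ _*_ (recip-inverse k) (recip-inverse 2)
    factor : ∀ ρ u r t κ S → ρ * u * (r * t) * κ + ρ * (r * S) ≡ ρ * r * (u * t * κ + S)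
    factor = solve-∀ ℚ-ring
    unfactor : ∀ ρ u r t g → ρ * r * (u * t * g) ≡ ρ * u * (r * t) * g
    unfactor = solve-∀ ℚ-ring
    1≤u : 1ℚ ≤ u
    1≤u = fromℕ-mono-≤ {1} {suc k} (ℕ.s≤s ℕ.z≤n)
    step-eq : X + u * (fromℕ 3 * g) ≡ S + 3M * g
    step-eq = trans (cong (λ z → X + z * (fromℕ 3 * g)) (sym (cong fromℕ eq))) (∑-step (G N) σ)
    step-le : u + w * X ≤ g + ε N
    step-le = subst (λ z → z + w * X ≤ g + ε N) (cong fromℕ eq) (G-step N σ)
    scaled : 3M * (u + w * X) ≤ 3M * (g + ε N)
    scaled = *ˡ-mono (0≤* 0≤M (0≤fromℕ 3)) step-le
    expand : ∀ L u w X → L * (u + w * X) ≡ L * u + w * L * X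
    expand = solve-∀ ℚ-ring
    scaled′ : 3M * u + X ≤ 3M * (g + ε N)
    scaled′ = subst (_≤ 3M * (g + ε N)) (trans (expand 3M u w X) (cong (λ z → 3M * u + z) (trans (cong (_* X) w*3M≡1) (*-identityˡ X)))) scaled
    rearrange : ∀ M t u e S X g → u * t * g ≡ u * t * (M - M * e) + S +
      ((M * t * (g + e) - (M * t * u + X)) + M * t * e * (u - 1ℚ) + (X + u * (t * g) - (S + M * t * g)))
    rearrange = solve-∀ ℚ-ring
    main : u * fromℕ 3 * κ N + S ≤ u * fromℕ 3 * g
    main = diff (0≤+ (0≤+ (p≤q⇒0≤q-p scaled′) (0≤* (0≤* (0≤* 0≤M (0≤fromℕ 3)) (0≤ε N)) (p≤q⇒0≤q-p 1≤u)))
                     (p≤q⇒0≤q-p (≤-reflexive (sym step-eq))))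
      (rearrange M (fromℕ 3) u (ε N) S X g)

  steps-satisfied : ∀ t {σ} → unsatisfied Φ σ ≡ [] → steps Φ (suc t) σ ≡ return 0
  steps-satisfied t {σ} eq with unsatisfied Φ σ | eq
  ... | _ | refl = refl

  steps-unsatisfied : ∀ t {σ e us} → unsatisfied Φ σ ≡ e ∷ us → steps Φ (suc t) σ ≡
    (uniform (e ∷ us) >>= λ e → uniform (vars e) >>= λ v → steps Φ t (flip v σ) >>= λ k → return (suc k))
  steps-unsatisfied t {σ} eq with unsatisfied Φ σ | eq
  ... | _ | refl = refl

  𝔼-steps-stop : ∀ N σ j → 𝔼 (return 0) (λ k → κ N * fromℕ (j ℕ.+ k)) ≤ κ N * fromℕ j + G N σ
  𝔼-steps-stop N σ j = ≤-trans (≤-reflexive (trans (𝔼-return 0 (λ k → κ N * fromℕ (j ℕ.+ k)))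
    (cong (λ k → κ N * fromℕ k) (ℕ.+-identityʳ j)))) (p≤p+q (0≤G N σ))

  -- Optional stopping for `G N`. The counter `j` holds the steps already made, so that the `suc`
  -- returned by each step moves into it. `κ N` may be negative for small N; no step of the
  -- induction depends on its sign.
  𝔼-steps : ∀ N t σ j → 𝔼 (steps Φ t σ) (λ k → κ N * fromℕ (j ℕ.+ k)) ≤ κ N * fromℕ j + G N σ
  𝔼-steps-suc : ∀ N t σ j us → unsatisfied Φ σ ≡ us →
    𝔼 (steps Φ (suc t) σ) (λ k → κ N * fromℕ (j ℕ.+ k)) ≤ κ N * fromℕ j + G N σ

  𝔼-steps N zero    σ j = 𝔼-steps-stop N σ j
  𝔼-steps N (suc t) σ j = 𝔼-steps-suc N t σ j (unsatisfied Φ σ) refl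

  𝔼-steps-suc N t σ j []              eq =
    subst (λ d → 𝔼 d (λ k → κ N * fromℕ (j ℕ.+ k)) ≤ κ N * fromℕ j + G N σ) (sym (steps-satisfied t eq)) (𝔼-steps-stop N σ j)
  𝔼-steps-suc N t σ j us@(e₀ ∷ us₀) eq = begin
    𝔼 (steps Φ (suc t) σ) h
      ≡⟨ cong (λ d → 𝔼 d h) (steps-unsatisfied t eq) ⟩
    𝔼 (uniform us >>= λ e → uniform (vars e) >>= next) h
      ≡⟨ 𝔼->>= (uniform us) (λ e → uniform (vars e) >>= next) h ⟩
    𝔼 (uniform us) (λ e → 𝔼 (uniform (vars e) >>= next) h)
      ≡⟨ 𝔼-uniform us (λ e → 𝔼 (uniform (vars e) >>= next) h) ⟩
    ρ * ∑ us (λ e → 𝔼 (uniform (vars e) >>= next) h)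
      ≡⟨ cong (ρ *_) (ℚΣ.sum-cong us λ e → trans (𝔼->>= (uniform (vars e)) next h) (𝔼-uniform (vars e) (λ v → 𝔼 (next v) h))) ⟩
    ρ * ∑ us (λ e → recip 3 * ∑ (vars e) (λ v → 𝔼 (next v) h))
      ≤⟨ *ˡ-mono (0≤recip (length us)) (∑-mono us λ e → *ˡ-mono (0≤recip 3) (∑-mono (vars e) bound)) ⟩
    ρ * ∑ us (λ e → recip 3 * ∑ (vars e) (λ v → κ N * fromℕ (suc j) + G N (flip v σ)))
      ≡⟨ cong (ρ *_) (ℚΣ.sum-cong us λ e → triple (κ N * fromℕ (suc j)) (G N (flip (x₁ e) σ)) (G N (flip (x₂ e) σ)) (G N (flip (x₃ e) σ))) ⟩
    ρ * ∑ us (λ e → κ N * fromℕ (suc j) + recip 3 * flips e)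
      ≡⟨ cong (ρ *_) (trans (ℚΣ.sum-∙ us (λ _ → κ N * fromℕ (suc j)) (λ e → recip 3 * flips e)) (cong₂ _+_ (∑-const (κ N * fromℕ (suc j)) us) (∑-*ˡ (recip 3) us flips))) ⟩
    ρ * (fromℕ (length us) * (κ N * fromℕ (suc j)) + recip 3 * S)
      ≡⟨ cong (λ z → ρ * (fromℕ (length us) * (κ N * z) + recip 3 * S)) (fromℕ-suc j) ⟩
    ρ * (fromℕ (length us) * (κ N * (1ℚ + fromℕ j)) + recip 3 * S)
      ≡⟨ collect ρ (fromℕ (length us)) (κ N) (fromℕ j) (recip 3 * S) ⟩
    ρ * fromℕ (length us) * (κ N * (1ℚ + fromℕ j)) + ρ * (recip 3 * S)
      ≡⟨ cong (λ z → z * (κ N * (1ℚ + fromℕ j)) + ρ * (recip 3 * S)) (recip-inverse (length us₀)) ⟩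
    1ℚ * (κ N * (1ℚ + fromℕ j)) + ρ * (recip 3 * S)
      ≡⟨ split (κ N) (fromℕ j) (ρ * (recip 3 * S)) ⟩
    κ N * fromℕ j + (κ N + ρ * (recip 3 * S))
      ≤⟨ +-monoʳ-≤ (κ N * fromℕ j) (subst (λ xs → κ N + ρ * (recip 3 * ∑ xs flips) ≤ G N σ) eq (drift N σ (cong length eq))) ⟩
    κ N * fromℕ j + G N σ ∎
    where
    open ≤-Reasoning
    h : ℕ → ℚ
    h k = κ N * fromℕ (j ℕ.+ k)
    next : Fin n → Dist ℕ
    next v = steps Φ t (flip v σ) >>= λ k → return (suc k)
    flips : Equation n → ℚ
    flips e = ∑ (vars e) (λ v → G N (flip v σ))
    ρ S : ℚ
    ρ = recip (length us)
    S = ∑ us flips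
    bound : ∀ v → 𝔼 (next v) h ≤ κ N * fromℕ (suc j) + G N (flip v σ)
    bound v = ≤-trans (≤-reflexive (trans (𝔼->>= (steps Φ t (flip v σ)) (λ k → return (suc k)) h) (𝔼-cong (steps Φ t (flip v σ)) λ k →
      trans (𝔼-return (suc k) h) (cong (λ k → κ N * fromℕ k) (ℕ.+-suc j k))))) (𝔼-steps N t (flip v σ) (suc j))
    triple : ∀ c x y z → recip 3 * (c + x + (c + y + (c + z + 0ℚ))) ≡ c + recip 3 * (x + (y + (z + 0ℚ)))
    triple c x y z = trans (lemma (recip 3) c x y z) (cong (λ t → t + recip 3 * (x + (y + (z + 0ℚ)))) (trans (cong (_* c) (recip-inverse 2)) (*-identityˡ c)))
      where
      lemma : ∀ r c x y z → r * (c + x + (c + y + (c + z + 0ℚ))) ≡ r * (1ℚ + 1ℚ + 1ℚ) * c + r * (x + (y + (z + 0ℚ)))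
      lemma = solve-∀ ℚ-ring
    collect : ∀ ρ l κ j s → ρ * (l * (κ * (1ℚ + j)) + s) ≡ ρ * l * (κ * (1ℚ + j)) + ρ * s
    collect = solve-∀ ℚ-ring
    split : ∀ κ j s → 1ℚ * (κ * (1ℚ + j)) + s ≡ κ * j + (κ + s)
    split = solve-∀ ℚ-ring

  -- The cut bound says nothing about the two absorbing sets; there `h` vanishes and `D` is
  -- nonnegative.
  proper-bound : ∀ γ → (∀ B → 0 ℕ.< ∣ B ∣ → ∣ B ∣ ℕ.< m → γ ≤ D B) → ∀ c (h : Subset m → ℚ) →
    h ⊥ ≡ 0ℚ → h ⊤ ≡ 0ℚ → (∀ B → h B ≤ c) → 0ℚ ≤ c → 0ℚ ≤ γ → ∀ B → γ * h B ≤ c * D B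
  proper-bound γ γ≤D c h h⊥ h⊤ h≤c 0≤c 0≤γ B with empty-full-proper B
  ... | inj₁ refl        = subst (_≤ c * D ⊥) (sym (trans (cong (γ *_) h⊥) (*-zeroʳ γ))) (0≤* 0≤c (0≤D ⊥))
  ... | inj₂ (inj₁ refl) = subst (_≤ c * D ⊤) (sym (trans (cong (γ *_) h⊤) (*-zeroʳ γ))) (0≤* 0≤c (0≤D ⊤))
  ... | inj₂ (inj₂ (0<k , k<m)) = begin
    γ * h B ≤⟨ *ˡ-mono 0≤γ (h≤c B) ⟩
    γ * c   ≡⟨ *-comm γ c ⟩
    c * γ   ≤⟨ *ˡ-mono 0≤c (γ≤D B 0<k k<m) ⟩
    c * D B ∎
    where open ≤-Reasoning

  expectation-bound : ∀ γ → 0ℚ < γ → (∀ B → 0 ℕ.< ∣ B ∣ → ∣ B ∣ ℕ.< m → γ ≤ D B) →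
    ∀ t σ → γ * 𝔼 (steps Φ t σ) fromℕ ≤ 3M * (M - 1ℚ)
  expectation-bound γ 0<γ γ≤D t σ = vanishing-error 0<γ 0≤Z λ N → ε N , Y-εY≤Z N , Nε≤C N
    where
    open ≤-Reasoning
    E Y Z : ℚ
    E = 𝔼 (steps Φ t σ) fromℕ
    Y = γ * E
    Z = 3M * (M - 1ℚ)
    0≤γ : 0ℚ ≤ γ
    0≤γ = <⇒≤ 0<γ
    0≤Z : 0ℚ ≤ Z
    0≤Z = 0≤* (0≤* 0≤M (0≤fromℕ 3)) (p≤q⇒0≤q-p 1≤M)
    -- The rate 1/N: N · P^N ψ is at most the truncated potential of `ψ`, and `R-bound` applies to
    -- it with c = m² because ψ ≤ m².
    Nε≤C : ∀ N → γ * (fromℕ N * ε N) ≤ M * (M * M * 3M * (M - 1ℚ))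
    Nε≤C N = begin
      γ * (fromℕ N * ε N)
        ≡⟨ cong (γ *_) (∑-*ˡ (fromℕ N) starts _) ⟨
      γ * ∑ starts (λ x → fromℕ N * P^ N ψ ⁅ x ⁆)
        ≤⟨ *ˡ-mono 0≤γ (∑-mono starts λ x → N*P^N≤R P-ψ≤ψ N ⁅ x ⁆) ⟩
      γ * ∑ starts (λ x → R N ψ ⁅ x ⁆)
        ≡⟨ ∑-*ˡ γ starts _ ⟨
      ∑ starts (λ x → γ * R N ψ ⁅ x ⁆)
        ≤⟨ ∑-mono starts (λ x → R-bound γ (M * M) ψ (proper-bound γ γ≤D (M * M) ψ ψ-⊥ ψ-⊤ ψ≤M² (0≤* 0≤M 0≤M) 0≤γ) (0≤* 0≤M 0≤M) N ⁅ x ⁆) ⟩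
      ∑ starts (λ x → M * M * 3M * ψ ⁅ x ⁆)
        ≡⟨ ℚΣ.sum-cong starts (λ x → cong (M * M * 3M *_) (ψ-⁅⁆ x)) ⟩
      ∑ starts (λ _ → M * M * 3M * (M - 1ℚ))
        ≡⟨ ∑-starts (M * M * 3M * (M - 1ℚ)) ⟩
      M * (M * M * 3M * (M - 1ℚ)) ∎
    -- Here `R-bound` is used with c = 1, as the parity is at most 1. The factor m from the m
    -- singletons is later cancelled against the drift.
    γG≤MZ : ∀ N → γ * G N σ ≤ M * Z
    γG≤MZ N = begin
      γ * G N σ
        ≡⟨ ∑-*ˡ γ starts _ ⟨
      ∑ starts (λ x → γ * R N (χ σ) ⁅ x ⁆)
        ≤⟨ ∑-mono starts (λ x → R-bound γ 1ℚ (χ σ) (proper-bound γ γ≤D 1ℚ (χ σ) (cong ι (parity-⊥ σ)) (cong ι (parity-⊤ satisfiable σ)) (λ B → ι≤1 (parity σ B)) (0≤fromℕ 1) 0≤γ) (0≤fromℕ 1) N ⁅ x ⁆) ⟩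
      ∑ starts (λ x → 1ℚ * 3M * ψ ⁅ x ⁆)
        ≡⟨ ℚΣ.sum-cong starts (λ x → cong₂ _*_ (*-identityˡ 3M) (ψ-⁅⁆ x)) ⟩
      ∑ starts (λ _ → Z)
        ≡⟨ ∑-starts Z ⟩
      M * Z ∎
    κE≤G : ∀ N → κ N * E ≤ G N σ
    κE≤G N = begin
      κ N * E
        ≡⟨ ∑-*ˡ (κ N) (steps Φ t σ) _ ⟨
      ∑ (steps Φ t σ) (λ (p , k) → κ N * (p * fromℕ k))
        ≡⟨ ℚΣ.sum-cong (steps Φ t σ) (λ (p , k) → commute (κ N) p (fromℕ k)) ⟩
      𝔼 (steps Φ t σ) (λ k → κ N * fromℕ k)
        ≤⟨ 𝔼-steps N t σ 0 ⟩
      κ N * 0ℚ + G N σ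
        ≡⟨ trans (cong (_+ G N σ) (*-zeroʳ (κ N))) (+-identityˡ (G N σ)) ⟩
      G N σ ∎
      where
      commute : ∀ κ p k → κ * (p * k) ≡ p * (κ * k)
      commute = solve-∀ ℚ-ring
    Y-εY≤Z : ∀ N → Y - ε N * Y ≤ Z
    Y-εY≤Z N = *ˡ-cancel (<-≤-trans (0<fromℕ-suc 0) 1≤M) (begin
      M * (Y - ε N * Y)        ≡⟨ factor M γ (ε N) E ⟩
      γ * (κ N * E)            ≤⟨ *ˡ-mono 0≤γ (κE≤G N) ⟩
      γ * G N σ                ≤⟨ γG≤MZ N ⟩
      M * Z                    ∎)
      where
      factor : ∀ M γ e E → M * (γ * E - e * (γ * E)) ≡ γ * ((M - M * e) * E)
      factor = solve-∀ ℚ-ring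

-- Sums of indicators, subsets, and a working form of connectedness

ι-∧ : ∀ a b → ι (a ∧ b) ≡ ι a * ι b
ι-∧ true  b = sym (*-identityˡ (ι b))
ι-∧ false b = sym (*-zeroˡ (ι b))

ι-not : ∀ b → ι (not b) ≡ 1ℚ - ι b
ι-not true  = refl
ι-not false = refl

if-ι : ∀ b x → (if b then x else 0ℚ) ≡ ι b * x
if-ι true  x = sym (*-identityˡ x)
if-ι false x = sym (*-zeroˡ x)

∑-*ʳ : {A : Set} (xs : List A) (f : A → ℚ) (c : ℚ) → ∑ xs (λ x → f x * c) ≡ ∑ xs f * c
∑-*ʳ xs f c = trans (ℚΣ.sum-cong xs λ x → *-comm (f x) c) (trans (∑-*ˡ c xs f) (*-comm c (∑ xs f)))

∑-ι-≤1 : ∀ {k} (b : Fin k → Bool) → (∀ v w → b v ≡ true → b w ≡ true → v ≡ w) → ∑ (allFin k) (ι ∘ b) ≤ 1ℚ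
∑-ι-≤1 {k} b unique with any? (λ v → b v Bool.≟ true)
... | yes (v₀ , bv₀) = ≤-trans (∑-mono (allFin k) below) (≤-reflexive (ℚΣ.sum-δ v₀ (λ _ → 1ℚ)))
  where
  below : ∀ v → ι (b v) ≤ (if does (v ≟ v₀) then 1ℚ else 0ℚ)
  below v with b v Bool.≟ true
  ... | yes bv rewrite dec-true (v ≟ v₀) (unique v v₀ bv bv₀) = ι≤1 (b v)
  ... | no ¬bv rewrite Bool.¬-not ¬bv = 0≤ι (does (v ≟ v₀))
... | no none = ≤-trans (≤-reflexive (trans (ℚΣ.sum-cong (allFin k) λ v → cong ι (Bool.¬-not (λ bv → none (v , bv)))) (ℚΣ.sum-ε (allFin k)))) (0≤fromℕ 1)

term≤∑ : ∀ {k} (f : Fin k → ℚ) → (∀ v → 0ℚ ≤ f v) → ∀ v → f v ≤ ∑ (allFin k) f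
term≤∑ {k} f 0≤f v₀ = subst (_≤ ∑ (allFin k) f) (ℚΣ.sum-δ v₀ f) (∑-mono (allFin k) below)
  where
  below : ∀ v → (if does (v ≟ v₀) then f v else 0ℚ) ≤ f v
  below v with does (v ≟ v₀)
  ... | true  = ≤-refl
  ... | false = 0≤f v

recip-anti : ∀ {j k} → suc j ℕ.≤ k → recip k ≤ recip (suc j)
recip-anti {j} {suc k} j<k = begin
  recip (suc k)                                    ≡⟨ *-identityʳ _ ⟨
  recip (suc k) * 1ℚ                               ≡⟨ cong (recip (suc k) *_) (recip-inverse j) ⟨
  recip (suc k) * (recip (suc j) * fromℕ (suc j))  ≤⟨ *ˡ-mono (0≤recip (suc k)) (*ˡ-mono (0≤recip (suc j)) (fromℕ-mono-≤ {suc j} {suc k} j<k)) ⟩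
  recip (suc k) * (recip (suc j) * fromℕ (suc k))  ≡⟨ swap (recip (suc k)) (recip (suc j)) (fromℕ (suc k)) ⟩
  recip (suc j) * (recip (suc k) * fromℕ (suc k))  ≡⟨ cong (recip (suc j) *_) (recip-inverse k) ⟩
  recip (suc j) * 1ℚ                               ≡⟨ *-identityʳ _ ⟩
  recip (suc j)                                    ∎
  where
  open ≤-Reasoning
  swap : ∀ a b c → a * (b * c) ≡ b * (a * c)
  swap = solve-∀ ℚ-ring

∣p∪q∣≤∣p∣+∣q∣ : ∀ {k} (p q : Subset k) → ∣ p ∪ q ∣ ℕ.≤ ∣ p ∣ ℕ.+ ∣ q ∣
∣p∪q∣≤∣p∣+∣q∣ []          []          = ℕ.z≤n
∣p∪q∣≤∣p∣+∣q∣ (true ∷ p)  (true ∷ q)  = ℕ.s≤s (ℕ.≤-trans (∣p∪q∣≤∣p∣+∣q∣ p q) (ℕ.+-monoʳ-≤ ∣ p ∣ (ℕ.n≤1+n ∣ q ∣)))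
∣p∪q∣≤∣p∣+∣q∣ (true ∷ p)  (false ∷ q) = ℕ.s≤s (∣p∪q∣≤∣p∣+∣q∣ p q)
∣p∪q∣≤∣p∣+∣q∣ (false ∷ p) (true ∷ q)  = subst (suc ∣ p ∪ q ∣ ℕ.≤_) (sym (ℕ.+-suc ∣ p ∣ ∣ q ∣)) (ℕ.s≤s (∣p∪q∣≤∣p∣+∣q∣ p q))
∣p∪q∣≤∣p∣+∣q∣ (false ∷ p) (false ∷ q) = ∣p∪q∣≤∣p∣+∣q∣ p q

proper⇒∉ : ∀ {k} (B : Subset k) → ∣ B ∣ ℕ.< k → ∃ λ j → Vec.lookup B j ≡ false
proper⇒∉ (false ∷ B) _   = zero , refl
proper⇒∉ (true ∷ B)  lt with j , eq ← proper⇒∉ B (ℕ.s<s⁻¹ lt) = suc j , eq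

nonempty⇒∈ : ∀ {k} (B : Subset k) → 0 ℕ.< ∣ B ∣ → ∃ λ i → Vec.lookup B i ≡ true
nonempty⇒∈ (true ∷ B)  _   = zero , refl
nonempty⇒∈ (false ∷ B) lt with i , eq ← nonempty⇒∈ B lt = suc i , eq

module _ {A : Set} {P : Pred A 0ℓ} (P? : Decidable P) where

  filter-↭ : ∀ xs → xs ↭ filter P? xs ++ filter (¬? ∘ P?) xs
  filter-↭ []       = ↭-refl
  filter-↭ (x ∷ xs) with P? x
  ... | yes _ = prep x (filter-↭ xs)
  ... | no  _ = ↭-trans (prep x (filter-↭ xs)) (↭-sym (shift x (filter P? xs) (filter (¬? ∘ P?) xs)))

-- Connectedness as propagation: a decidable property that never changes across a shared variable
-- splits the formula into two variable-disjoint parts, one of which must be empty.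
connected-dichotomy : ∀ {n} {Ψ : Formula n} → Connected Ψ → {P : Pred (Equation n) 0ℓ} → Decidable P →
  (∀ {e f} → e ∈ Ψ → f ∈ Ψ → P e → ¬ P f → ∀ v → v ∈ vars e → v ∉ vars f) →
  ∀ {e f} → e ∈ Ψ → f ∈ Ψ → P e → P f
connected-dichotomy {Ψ = Ψ} connected {P} P? separated {e} {f} e∈Ψ f∈Ψ Pe = decidable-stable (P? f) λ ¬Pf →
  [ absurd (∈-filter⁺ P? e∈Ψ Pe) , absurd (∈-filter⁺ (¬? ∘ P?) f∈Ψ ¬Pf) ]′
    (connected (filter P? Ψ) (filter (¬? ∘ P?) Ψ) (filter-↭ P? Ψ) disjoint)
  where
  absurd : ∀ {x} {xs : Formula _} {A : Set} → x ∈ xs → xs ≡ [] → A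
  absurd () refl
  disjoint : VariableDisjoint (filter P? Ψ) (filter (¬? ∘ P?) Ψ)
  disjoint v (v∈₁ , v∈₂)
    with g , g∈ , v∈g ← find v∈₁ | h , h∈ , v∈h ← find v∈₂
    with g∈Ψ , Pg ← ∈-filter⁻ P? g∈ | h∈Ψ , ¬Ph ← ∈-filter⁻ (¬? ∘ P?) h∈ = separated g∈Ψ h∈Ψ Pg ¬Ph v v∈g v∈h

-- Cuts of the clause graph and an upper bound on the connectivity

module Geometry {n : ℕ} (Φ : Formula n) (reduced : Reduced Φ) (regular : 2-Regular Φ) (satisfiable : Satisfiable Φ) (0<m : 0 ℕ.< length Φ) where

  open import Data.List.Membership.DecPropositional (_≟_ {n}) using (_∈?_)
  open Incidence Φ regular
  open Walk Φ regular satisfiable 0<m hiding (w)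
  open Graph (T₃ Φ)

  two-shared : ∀ {v w i j} → v ≢ w → v ∈ scope i → v ∈ scope j → w ∈ scope i → w ∈ scope j → i ≡ j
  two-shared {v} {w} {i} {j} v≢w v∈i v∈j w∈i w∈j = decidable-stable (i ≟ j) λ i≢j →
    proj₂ reduced i j i≢j v w v≢w (v∈i , v∈j , w∈i , w∈j)

  -- By reducedness this is the adjacency matrix of `T₃ Φ` off the diagonal, with 3 on the diagonal.
  -- As a sum over variables it turns edge counts into exchanges of sums.
  common : Fin m → Fin m → ℚ
  common i j = ∑ (allFin n) (λ v → ι (incident i v ∧ incident j v))

  incident⇒∈ : ∀ i v → incident i v ≡ true → v ∈ scope i
  incident⇒∈ i v eq = decidable-stable (v ∈? scope i) λ v∉i → contradiction (trans (sym eq) (dec-false (v ∈? scope i) v∉i)) λ ()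

  ∧-true : ∀ a b → a ∧ b ≡ true → a ≡ true × b ≡ true
  ∧-true true true _ = refl , refl

  shared⇒∈ : ∀ i j v → incident i v ∧ incident j v ≡ true → v ∈ scope i × v ∈ scope j
  shared⇒∈ i j v eq with p , q ← ∧-true (incident i v) (incident j v) eq = incident⇒∈ i v p , incident⇒∈ j v q

  0≤common : ∀ i j → 0ℚ ≤ common i j
  0≤common i j = 0≤∑ (allFin n) λ v → 0≤ι (incident i v ∧ incident j v)

  common≤1 : ∀ {i j} → i ≢ j → common i j ≤ 1ℚ
  common≤1 {i} {j} i≢j = ∑-ι-≤1 _ λ v w pv pw → decidable-stable (v ≟ w) λ v≢w →
    let v∈i , v∈j = shared⇒∈ i j v pv ; w∈i , w∈j = shared⇒∈ i j w pw
    in i≢j (two-shared v≢w v∈i v∈j w∈i w∈j)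

  1≤common : ∀ {i j} v → v ∈ scope i → v ∈ scope j → 1ℚ ≤ common i j
  1≤common {i} {j} v v∈i v∈j = subst (_≤ common i j)
    (cong₂ (λ a b → ι (a ∧ b)) (dec-true (v ∈? scope i) v∈i) (dec-true (v ∈? scope j) v∈j))
    (term≤∑ _ (λ v → 0≤ι (incident i v ∧ incident j v)) v)

  common-none : ∀ {i j} → (∀ v → v ∈ scope i → v ∉ scope j) → common i j ≡ 0ℚ
  common-none {i} {j} none = trans (ℚΣ.sum-cong (allFin n) λ v →
    cong ι (Bool.¬-not λ eq → none v (proj₁ (shared⇒∈ i j v eq)) (proj₂ (shared⇒∈ i j v eq)))) (ℚΣ.sum-ε (allFin n))

  degree-3 : ∀ i → ∑ (allFin n) (λ v → ι (incident i v)) ≡ fromℕ 3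
  degree-3 i = sym (Hℚ.sum-vars (clause i) (λ _ → 1ℚ))

  common-self : ∀ i → common i i ≡ fromℕ 3
  common-self i = trans (ℚΣ.sum-cong (allFin n) λ v → cong ι (Bool.∧-idem (incident i v))) (degree-3 i)

  ∑-incident : ∀ v (f : Fin m → ℚ) → ∑ (allFin m) (λ i → f i * ι (incident i v)) ≡ f (end₁ v) + f (end₂ v)
  ∑-incident v f = trans (ℚΣ.sum-cong (allFin m) λ i → trans (*-comm (f i) _) (sym (if-ι (incident i v) (f i)))) (Hℚ.sum-incident v f)

  -- The clause i itself contributes 3 to this sum, and each of its three neighbours 1.
  ∑-common : ∀ i → ∑ (allFin m) (common i) ≡ fromℕ 6
  ∑-common i = begin
    ∑ (allFin m) (common i)
      ≡⟨ ℚΣ.sum-swap (allFin m) (allFin n) _ ⟩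
    ∑ (allFin n) (λ v → ∑ (allFin m) (λ j → ι (incident i v ∧ incident j v)))
      ≡⟨ ℚΣ.sum-cong (allFin n) (λ v → trans (ℚΣ.sum-cong (allFin m) λ j → ι-∧ (incident i v) (incident j v)) (∑-incident v (λ _ → ι (incident i v)))) ⟩
    ∑ (allFin n) (λ v → ι (incident i v) + ι (incident i v))
      ≡⟨ trans (ℚΣ.sum-∙ (allFin n) _ _) (cong₂ _+_ (degree-3 i) (degree-3 i)) ⟩
    fromℕ 3 + fromℕ 3 ∎
    where open ≡-Reasoning

  cut : (Fin m → Bool) → ℚ
  cut b = ∑ (allFin m) (λ i → ∑ (allFin m) (λ j → ι (b i) * ι (not (b j)) * common i j))

  crossing : (Fin m → Bool) → Fin n → ℚ
  crossing b v = (ι (b (end₁ v)) - ι (b (end₂ v))) * (ι (b (end₁ v)) - ι (b (end₂ v)))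

  -- After exchanging the sums, a variable contributes the number of its ends inside times the
  -- number of its ends outside, which is 2 · 0, 1 · 1 or 0 · 2.
  cut≡∑-crossing : ∀ b → cut b ≡ ∑ (allFin n) (crossing b)
  cut≡∑-crossing b = begin
    cut b
      ≡⟨ ℚΣ.sum-cong (allFin m) (λ i → trans (ℚΣ.sum-cong (allFin m) (λ j → sym (∑-*ˡ (ι (b i) * ι (not (b j))) (allFin n) _))) (ℚΣ.sum-swap (allFin m) (allFin n) _)) ⟩
    ∑ (allFin m) (λ i → ∑ (allFin n) (λ v → ∑ (allFin m) (λ j → ι (b i) * ι (not (b j)) * ι (incident i v ∧ incident j v))))
      ≡⟨ ℚΣ.sum-cong (allFin m) (λ i → ℚΣ.sum-cong (allFin n) (λ v → trans (ℚΣ.sum-cong (allFin m) (λ j → separate i j v)) (trans (∑-*ˡ (ι (b i) * ι (incident i v)) (allFin m) _) (cong (ι (b i) * ι (incident i v) *_) (∑-incident v (ι ∘ not ∘ b)))))) ⟩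
    ∑ (allFin m) (λ i → ∑ (allFin n) (λ v → ι (b i) * ι (incident i v) * outside v))
      ≡⟨ ℚΣ.sum-swap (allFin m) (allFin n) _ ⟩
    ∑ (allFin n) (λ v → ∑ (allFin m) (λ i → ι (b i) * ι (incident i v) * outside v))
      ≡⟨ ℚΣ.sum-cong (allFin n) (λ v → trans (∑-*ʳ (allFin m) (λ i → ι (b i) * ι (incident i v)) (outside v)) (cong (_* outside v) (∑-incident v (ι ∘ b)))) ⟩
    ∑ (allFin n) (λ v → (ι (b (end₁ v)) + ι (b (end₂ v))) * outside v)
      ≡⟨ ℚΣ.sum-cong (allFin n) (λ v → evaluate (b (end₁ v)) (b (end₂ v))) ⟩
    ∑ (allFin n) (crossing b) ∎
    where
    open ≡-Reasoning
    outside : Fin n → ℚ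
    outside v = ι (not (b (end₁ v))) + ι (not (b (end₂ v)))
    separate′ : ∀ p q r s → p * q * (r * s) ≡ p * r * (q * s)
    separate′ = solve-∀ ℚ-ring
    separate : ∀ i j v → ι (b i) * ι (not (b j)) * ι (incident i v ∧ incident j v) ≡ ι (b i) * ι (incident i v) * (ι (not (b j)) * ι (incident j v))
    separate i j v = trans (cong (ι (b i) * ι (not (b j)) *_) (ι-∧ (incident i v) (incident j v))) (separate′ (ι (b i)) (ι (not (b j))) (ι (incident i v)) (ι (incident j v)))
    evaluate : ∀ x y → (ι x + ι y) * (ι (not x) + ι (not y)) ≡ (ι x - ι y) * (ι x - ι y)
    evaluate true  true  = refl
    evaluate true  false = refl
    evaluate false true  = refl
    evaluate false false = refl

  cut-not : ∀ b → cut (not ∘ b) ≡ cut b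
  cut-not b = trans (cut≡∑-crossing (not ∘ b)) (trans (ℚΣ.sum-cong (allFin n) λ v →
    evaluate (b (end₁ v)) (b (end₂ v))) (sym (cut≡∑-crossing b)))
    where
    evaluate : ∀ x y → (ι (not x) - ι (not y)) * (ι (not x) - ι (not y)) ≡ (ι x - ι y) * (ι x - ι y)
    evaluate true  true  = refl
    evaluate true  false = refl
    evaluate false true  = refl
    evaluate false false = refl

  D≡2cut : ∀ B → D B ≡ cut (Vec.lookup B) + cut (Vec.lookup B)
  D≡2cut B = trans (Hℚ.sum-moves _) (trans (ℚΣ.sum-cong (allFin n) λ v → reflect (ι (Vec.lookup B (end₁ v))) (ι (Vec.lookup B (end₂ v))))
    (trans (ℚΣ.sum-∙ (allFin n) _ _) (sym (cong₂ _+_ (cut≡∑-crossing (Vec.lookup B)) (cut≡∑-crossing (Vec.lookup B))))))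
    where
    reflect : ∀ x y → (y - x) * (y - x) + (x - y) * (x - y) ≡ (x - y) * (x - y) + (x - y) * (x - y)
    reflect = solve-∀ ℚ-ring

  -- A vertex of b has three neighbours, at most |b| - 1 of which lie in b.
  cut-bound : ∀ b → let K = ∑ (allFin m) (ι ∘ b) in K * (fromℕ 4 - K) ≤ cut b
  cut-bound b = begin
    K * (fromℕ 4 - K)
      ≡⟨ ∑-*ʳ (allFin m) (ι ∘ b) (fromℕ 4 - K) ⟨
    ∑ (allFin m) (λ i → ι (b i) * (fromℕ 4 - K))
      ≤⟨ ∑-mono (allFin m) (λ i → row i (b i) refl) ⟩
    ∑ (allFin m) (λ i → ∑ (allFin m) (λ j → ι (b i) * (ι (not (b j)) * common i j)))
      ≡⟨ ℚΣ.sum-cong (allFin m) (λ i → ℚΣ.sum-cong (allFin m) (λ j → sym (*-assoc (ι (b i)) (ι (not (b j))) (common i j)))) ⟩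
    cut b ∎
    where
    open ≤-Reasoning
    K : ℚ
    K = ∑ (allFin m) (ι ∘ b)
    -- Summed over `j` this reads 6 ≤ r + (K + 2), with r the number of edges leaving `i`: members
    -- of `b` are charged 1, and the 2 tops up the diagonal entry 3.
    entry : ∀ i j → b i ≡ true → common i j ≤ ι (not (b j)) * common i j + (ι (b j) + (if does (j ≟ i) then fromℕ 2 else 0ℚ))
    entry i j bi with j ≟ i | b j in bj
    ... | yes refl | true  = ≤-reflexive (trans (common-self i) (three (common i i)))
      where
      three : ∀ x → 1ℚ + 1ℚ + 1ℚ ≡ 0ℚ * x + (1ℚ + (1ℚ + 1ℚ))
      three = solve-∀ ℚ-ring
    ... | yes refl | false = contradiction (trans (sym bi) bj) λ ()
    ... | no j≢i   | true  = ≤-trans (common≤1 (≢-sym j≢i)) (≤-reflexive (one (common i j)))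
      where
      one : ∀ x → 1ℚ ≡ 0ℚ * x + (1ℚ + 0ℚ)
      one = solve-∀ ℚ-ring
    ... | no j≢i   | false = ≤-reflexive (all (common i j))
      where
      all : ∀ x → x ≡ 1ℚ * x + (0ℚ + 0ℚ)
      all = solve-∀ ℚ-ring
    isolate : ∀ K → 1ℚ + 1ℚ + 1ℚ + 1ℚ - K ≡ 1ℚ + 1ℚ + 1ℚ + 1ℚ + 1ℚ + 1ℚ - (K + (1ℚ + 1ℚ))
    isolate = solve-∀ ℚ-ring
    restore : ∀ r x → r ≡ r + x - x
    restore = solve-∀ ℚ-ring
    row-true : ∀ i → b i ≡ true → fromℕ 4 - K ≤ ∑ (allFin m) (λ j → ι (not (b j)) * common i j)
    row-true i bi = begin
      fromℕ 4 - K
        ≡⟨ isolate K ⟩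
      fromℕ 6 - (K + fromℕ 2)
        ≤⟨ +-monoˡ-≤ (- (K + fromℕ 2)) (begin
          fromℕ 6
            ≡⟨ ∑-common i ⟨
          ∑ (allFin m) (common i)
            ≤⟨ ∑-mono (allFin m) (λ j → entry i j bi) ⟩
          ∑ (allFin m) (λ j → ι (not (b j)) * common i j + (ι (b j) + (if does (j ≟ i) then fromℕ 2 else 0ℚ)))
            ≡⟨ trans (ℚΣ.sum-∙ (allFin m) _ _) (cong (λ z → r + z) (ℚΣ.sum-∙ (allFin m) _ _)) ⟩
          r + (K + ∑ (allFin m) (λ j → if does (j ≟ i) then fromℕ 2 else 0ℚ))
            ≡⟨ cong (λ z → r + (K + z)) (ℚΣ.sum-δ i (λ _ → fromℕ 2)) ⟩
          r + (K + fromℕ 2) ∎) ⟩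
      r + (K + fromℕ 2) - (K + fromℕ 2)
        ≡⟨ restore r (K + fromℕ 2) ⟨
      r ∎
      where
      r : ℚ
      r = ∑ (allFin m) (λ j → ι (not (b j)) * common i j)
    row : ∀ i c → b i ≡ c → ι c * (fromℕ 4 - K) ≤ ∑ (allFin m) (λ j → ι c * (ι (not (b j)) * common i j))
    row i true  bi = ≤-trans (*ˡ-mono (0≤ι true) (row-true i bi)) (≤-reflexive (sym (∑-*ˡ 1ℚ (allFin m) _)))
    row i false bi = ≤-reflexive (trans (*-zeroˡ (fromℕ 4 - K)) (sym (trans (∑-*ˡ 0ℚ (allFin m) (λ j → ι (not (b j)) * common i j)) (*-zeroˡ (∑ (allFin m) (λ j → ι (not (b j)) * common i j))))))

  -- The row of `i` in `common` sums to 6 and has entries at most 1 beside the diagonal 3, so 6 ≤ m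
  -- + 2.
  4≤m : Fin m → 4 ℕ.≤ m
  4≤m i = ℕ.+-cancelʳ-≤ 2 4 m (fromℕ-cancel-≤ {6} {m ℕ.+ 2} (begin
    fromℕ 6                                                             ≡⟨ ∑-common i ⟨
    ∑ (allFin m) (common i)                                             ≤⟨ ∑-mono (allFin m) entry ⟩
    ∑ (allFin m) (λ j → 1ℚ + (if does (j ≟ i) then fromℕ 2 else 0ℚ))    ≡⟨ ℚΣ.sum-∙ (allFin m) _ _ ⟩
    ∑ (allFin m) (λ _ → 1ℚ) + ∑ (allFin m) (λ j → if does (j ≟ i) then fromℕ 2 else 0ℚ)
      ≡⟨ cong₂ _+_ (trans (∑-starts 1ℚ) (*-identityʳ M)) (ℚΣ.sum-δ i (λ _ → fromℕ 2)) ⟩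
    M + fromℕ 2                                                         ≡⟨ fromℕ-+ m 2 ⟨
    fromℕ (m ℕ.+ 2)                                                     ∎))
    where
    open ≤-Reasoning
    entry : ∀ j → common i j ≤ 1ℚ + (if does (j ≟ i) then fromℕ 2 else 0ℚ)
    entry j with j ≟ i
    ... | yes refl = ≤-reflexive (common-self i)
    ... | no j≢i   = common≤1 (≢-sym j≢i)

  -- If every other clause met `i`, all entries of its row in `common` beside the diagonal 3 would
  -- be at least 1, so m + 2 ≤ 6.
  non-neighbour : 5 ℕ.≤ m → ∀ i → ∃ λ w → w ≢ i × (∀ v → v ∈ scope i → v ∉ scope w)
  non-neighbour 5≤m i with any? (λ w → ¬? (w ≟ i) ×-dec All.all? (λ v → ¬? (v ∈? scope w)) (scope i))
  ... | yes (w , w≢i , none) = w , w≢i , λ v v∈i → All.lookup none v∈i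
  ... | no all-adjacent = contradiction (ℕ.+-cancelʳ-≤ 2 m 4 (fromℕ-cancel-≤ {m ℕ.+ 2} {6} (begin
    fromℕ (m ℕ.+ 2)                                                     ≡⟨ fromℕ-+ m 2 ⟩
    M + fromℕ 2                                                         ≡⟨ cong₂ _+_ (trans (∑-starts 1ℚ) (*-identityʳ M)) (ℚΣ.sum-δ i (λ _ → fromℕ 2)) ⟨
    ∑ (allFin m) (λ _ → 1ℚ) + ∑ (allFin m) (λ j → if does (j ≟ i) then fromℕ 2 else 0ℚ)
                                                                        ≡⟨ ℚΣ.sum-∙ (allFin m) _ _ ⟨
    ∑ (allFin m) (λ j → 1ℚ + (if does (j ≟ i) then fromℕ 2 else 0ℚ))    ≤⟨ ∑-mono (allFin m) entry ⟩
    ∑ (allFin m) (common i)                                             ≡⟨ ∑-common i ⟩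
    fromℕ 6                                                             ∎))) (ℕ.<⇒≱ 5≤m)
    where
    open ≤-Reasoning
    entry : ∀ j → 1ℚ + (if does (j ≟ i) then fromℕ 2 else 0ℚ) ≤ common i j
    entry j with j ≟ i
    ... | yes refl = ≤-reflexive (sym (common-self i))
    ... | no j≢i with Any.any? (λ v → v ∈? scope j) (scope i)
    ...   | yes some with v , v∈i , v∈j ← find some = 1≤common v v∈i v∈j
    ...   | no none  = contradiction (j , j≢i , All.tabulate (λ v∈i v∈j → none (lose v∈i v∈j))) all-adjacent

  other-end : ∀ v i → v ∈ scope i → ∃ λ u → u ≢ i × v ∈ scope u × (∀ k → v ∈ scope k → k ≢ i → k ≡ u)
  other-end v i v∈i with ∈-ends v i v∈i
  ... | inj₁ refl = end₂ v , ≢-sym (end₁≢end₂ v) , ∈end₂ v , λ k v∈k k≢i → [ (λ eq → contradiction eq k≢i) , (λ eq → eq) ]′ (∈-ends v k v∈k)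
  ... | inj₂ refl = end₁ v , end₁≢end₂ v , ∈end₁ v , λ k v∈k k≢i → [ (λ eq → eq) , (λ eq → contradiction eq k≢i) ]′ (∈-ends v k v∈k)

  two-others : ∀ (e : Equation n) {v} → v ∈ vars e → ∃₂ λ y z → y ≢ z × y ≢ v × z ≢ v × y ∈ vars e × z ∈ vars e
  two-others e (here refl)                 = x₂ e , x₃ e , x₂≢x₃ e , ≢-sym (x₁≢x₂ e) , ≢-sym (x₁≢x₃ e) , there (here refl) , there (there (here refl))
  two-others e (there (here refl))         = x₁ e , x₃ e , x₁≢x₃ e , x₁≢x₂ e , ≢-sym (x₂≢x₃ e) , here refl , there (there (here refl))
  two-others e (there (there (here refl))) = x₁ e , x₂ e , x₁≢x₂ e , x₁≢x₃ e , x₂≢x₃ e , here refl , there (here refl)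

  member : ∀ {e} → e ∈ Φ → ∃ λ i → e ≡ clause i
  member e∈Φ = Any.index e∈Φ , lookup-index e∈Φ

  -- Deleting `y` removes the neighbour of `i` across `v` but keeps `i` and `w`.
  Blocks : (i w : Fin m) (v y : Fin n) → Set
  Blocks i w v y = (y ∉ scope i × y ∉ scope w) × (∀ k → v ∈ scope k → k ≢ i → y ∈ scope k)

  -- The neighbour u across `v` has two further variables. Neither lies in `i`, or u and `i` would
  -- share two variables. Not both lie in `w`, or u would equal `w` and `v` would be common to `i`
  -- and `w`.
  blocker : ∀ {i w} → (∀ v → v ∈ scope i → v ∉ scope w) → ∀ v → v ∈ scope i → ∃ (Blocks i w v)
  blocker {i} {w} apart v v∈i
    with u , u≢i , v∈u , unique ← other-end v i v∈i
    with y , z , y≢z , y≢v , z≢v , y∈u , z∈u ← two-others (clause u) v∈u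
    with y ∈? scope w
  ... | no y∉w  = y , ((λ y∈i → u≢i (two-shared y≢v y∈u y∈i v∈u v∈i)) , y∉w) ,
    λ k v∈k k≢i → subst (λ k → y ∈ scope k) (sym (unique k v∈k k≢i)) y∈u
  ... | yes y∈w = z , ((λ z∈i → u≢i (two-shared z≢v z∈u z∈i v∈u v∈i)) ,
      λ z∈w → apart v v∈i (subst (λ k → v ∈ scope k) (two-shared y≢z y∈u y∈w z∈u z∈w) v∈u)) ,
    λ k v∈k k≢i → subst (λ k → z ∈ scope k) (sym (unique k v∈k k≢i)) z∈u

  -- Deleting one further variable at each of the three neighbours of a clause i, chosen to avoid
  -- a non-neighbour w, separates i from w.
  module Isolate {i w : Fin m} (w≢i : w ≢ i) {y₁ y₂ y₃ : Fin n}
    (b₁ : Blocks i w (x₁ (clause i)) y₁) (b₂ : Blocks i w (x₂ (clause i)) y₂) (b₃ : Blocks i w (x₃ (clause i)) y₃) where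

    deleted : Subset n
    deleted = ⁅ y₁ ⁆ ∪ (⁅ y₂ ⁆ ∪ ⁅ y₃ ⁆)

    ∣deleted∣≤3 : ∣ deleted ∣ ℕ.≤ 3
    ∣deleted∣≤3 = ℕ.≤-trans (∣p∪q∣≤∣p∣+∣q∣ ⁅ y₁ ⁆ _) (ℕ.+-mono-≤ (ℕ.≤-reflexive (Subset.∣⁅x⁆∣≡1 y₁))
      (ℕ.≤-trans (∣p∪q∣≤∣p∣+∣q∣ ⁅ y₂ ⁆ ⁅ y₃ ⁆) (ℕ.≤-reflexive (cong₂ ℕ._+_ (Subset.∣⁅x⁆∣≡1 y₂) (Subset.∣⁅x⁆∣≡1 y₃)))))

    ∈deleted⁻ : ∀ {v} → v ∈ˢ deleted → v ∉ scope i × v ∉ scope w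
    ∈deleted⁻ v∈ with Subset.x∈p∪q⁻ ⁅ y₁ ⁆ _ v∈
    ... | inj₁ v∈₁ rewrite Subset.x∈⁅y⁆⇒x≡y y₁ v∈₁ = proj₁ b₁
    ... | inj₂ v∈′ with Subset.x∈p∪q⁻ ⁅ y₂ ⁆ ⁅ y₃ ⁆ v∈′
    ...   | inj₁ v∈₂ rewrite Subset.x∈⁅y⁆⇒x≡y y₂ v∈₂ = proj₁ b₂
    ...   | inj₂ v∈₃ rewrite Subset.x∈⁅y⁆⇒x≡y y₃ v∈₃ = proj₁ b₃

    y₁∈deleted : y₁ ∈ˢ deleted
    y₁∈deleted = Subset.x∈p∪q⁺ (inj₁ (Subset.x∈⁅x⁆ y₁))

    y₂∈deleted : y₂ ∈ˢ deleted
    y₂∈deleted = Subset.x∈p∪q⁺ {p = ⁅ y₁ ⁆} (inj₂ (Subset.x∈p∪q⁺ (inj₁ (Subset.x∈⁅x⁆ y₂))))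

    y₃∈deleted : y₃ ∈ˢ deleted
    y₃∈deleted = Subset.x∈p∪q⁺ {p = ⁅ y₁ ⁆} (inj₂ (Subset.x∈p∪q⁺ {p = ⁅ y₂ ⁆} (inj₂ (Subset.x∈⁅x⁆ y₃))))

    -- Singles out clause `i`: connectedness speaks of equations and not of positions, and by
    -- `two-shared` two variables already determine the position.
    P : Equation n → Set
    P e = x₁ (clause i) ∈ vars e × x₂ (clause i) ∈ vars e

    P? : Decidable P
    P? e = (x₁ (clause i) ∈? vars e) ×-dec (x₂ (clause i) ∈? vars e)

    P⇒≡i : ∀ k → P (clause k) → k ≡ i
    P⇒≡i k (x₁∈k , x₂∈k) = two-shared (x₁≢x₂ (clause i)) x₁∈k (here refl) x₂∈k (there (here refl))

    Kept : Equation n → Set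
    Kept e = All (λ v → ¬ v ∈ˢ deleted) (vars e)

    kept? : Decidable Kept
    kept? e = All.all? (λ v → ¬? (v Subset.∈? deleted)) (vars e)

    blocked : ∀ {v} k → v ∈ scope i → k ≢ i → v ∈ scope k → ¬ Kept (clause k)
    blocked k (here refl)                 k≢i v∈k kept = All.lookup kept (proj₂ b₁ k v∈k k≢i) y₁∈deleted
    blocked k (there (here refl))         k≢i v∈k kept = All.lookup kept (proj₂ b₂ k v∈k k≢i) y₂∈deleted
    blocked k (there (there (here refl))) k≢i v∈k kept = All.lookup kept (proj₂ b₃ k v∈k k≢i) y₃∈deleted

    separated : ∀ {e f} → ∃ (λ j → e ≡ clause j) → ∃ (λ k → f ≡ clause k) → Kept f →
      P e → ¬ P f → ∀ v → v ∈ vars e → v ∉ vars f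
    separated (j , refl) (k , refl) kept Pj ¬Pk v v∈j v∈k =
      blocked k (subst (λ j → v ∈ scope j) (P⇒≡i j Pj) v∈j) (λ { refl → ¬Pk (here refl , there (here refl)) }) v∈k kept

    disconnected : ¬ Connected (delete deleted Φ)
    disconnected connected = w≢i (P⇒≡i w (connected-dichotomy connected P?
      (λ e∈ f∈ → separated (member (proj₁ (∈-filter⁻ kept? {xs = Φ} e∈))) (member (proj₁ (∈-filter⁻ kept? {xs = Φ} f∈))) (proj₂ (∈-filter⁻ kept? {xs = Φ} f∈)))
      (survives i λ y∉ y∈ → proj₁ y∉ y∈) (survives w λ y∉ y∈ → proj₂ y∉ y∈) (here refl , there (here refl))))
      where
      survives : ∀ k → (∀ {y} → y ∉ scope i × y ∉ scope w → y ∉ scope k) → clause k ∈ delete deleted Φ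
      survives k avoid = ∈-filter⁺ kept? {xs = Φ} (∈-lookup k) (All.tabulate λ v∈k v∈deleted → avoid (∈deleted⁻ v∈deleted) v∈k)

  s≤3 : ∀ s → s -Connected Φ → 5 ℕ.≤ m → Fin m → s ℕ.≤ 3
  s≤3 s (_ , connected) 5≤m i
    with w , w≢i , apart ← non-neighbour 5≤m i
    with y₁ , b₁ ← blocker apart (x₁ (clause i)) (here refl)
       | y₂ , b₂ ← blocker apart (x₂ (clause i)) (there (here refl))
       | y₃ , b₃ ← blocker apart (x₃ (clause i)) (there (there (here refl)))
    = ℕ.≮⇒≥ λ 3<s → disconnected (connected deleted (ℕ.≤-trans (ℕ.s≤s ∣deleted∣≤3) 3<s))
    where open Isolate w≢i b₁ b₂ b₃

ι-does≤ : {A : Set} (a? : Dec A) {x : ℚ} → (A → 1ℚ ≤ x) → 0ℚ ≤ x → ι (does a?) ≤ x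
ι-does≤ (yes a) 1≤x 0≤x = 1≤x a
ι-does≤ (no _)  1≤x 0≤x = 0≤x

-- Lower bounds on cuts, and the flow in the definition of τ_C

module Bounds {n : ℕ} (Φ : Formula n) (reduced : Reduced Φ) (regular : 2-Regular Φ) (satisfiable : Satisfiable Φ) (0<m : 0 ℕ.< length Φ) where

  open import Data.List.Membership.DecPropositional (_≟_ {n}) using (_∈?_)
  open Incidence Φ regular
  open Walk Φ regular satisfiable 0<m hiding (w)
  open Geometry Φ reduced regular satisfiable 0<m

  -- Without a crossing variable, membership in `B` would spread along shared variables from a
  -- clause inside to one outside. Only finitely many variables have to be searched, so the
  -- refutation yields a witness.
  crossing-variable : Connected Φ → ∀ B → 0 ℕ.< ∣ B ∣ → ∣ B ∣ ℕ.< m →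
    ∃ λ v → Vec.lookup B (end₁ v) ≢ Vec.lookup B (end₂ v)
  crossing-variable connected B 0<k k<m =
    decidable-stable (any? λ v → ¬? (Vec.lookup B (end₁ v) Bool.≟ Vec.lookup B (end₂ v))) λ none →
      contradiction (trans (sym (P⇒∈ j (connected-dichotomy connected {P} P? (separated none) (∈-lookup i) (∈-lookup j) (∈⇒P i∈B)))) j∉B) λ ()
    where
    i j : Fin m
    i = proj₁ (nonempty⇒∈ B 0<k)
    j = proj₁ (proper⇒∉ B k<m)
    i∈B : Vec.lookup B i ≡ true
    i∈B = proj₂ (nonempty⇒∈ B 0<k)
    j∉B : Vec.lookup B j ≡ false
    j∉B = proj₂ (proper⇒∉ B k<m)
    -- Membership in `B` expressed for equations: a position in `B` is recognised by containing two
    -- given variables of the equation.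
    P : Equation n → Set
    P e = ∃ λ k → Vec.lookup B k ≡ true × x₁ e ∈ scope k × x₂ e ∈ scope k
    P? : Decidable P
    P? e = any? λ k → (Vec.lookup B k Bool.≟ true) ×-dec (x₁ e ∈? scope k) ×-dec (x₂ e ∈? scope k)
    ∈⇒P : ∀ {k} → Vec.lookup B k ≡ true → P (clause k)
    ∈⇒P {k} k∈B = k , k∈B , here refl , there (here refl)
    P⇒∈ : ∀ k → P (clause k) → Vec.lookup B k ≡ true
    P⇒∈ k (l , l∈B , x₁∈l , x₂∈l) = subst (λ l → Vec.lookup B l ≡ true)
      (two-shared (x₁≢x₂ (clause k)) x₁∈l (here refl) x₂∈l (there (here refl))) l∈B
    separated : ¬ (∃ λ v → Vec.lookup B (end₁ v) ≢ Vec.lookup B (end₂ v)) →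
      ∀ {e f} → e ∈ Φ → f ∈ Φ → P e → ¬ P f → ∀ v → v ∈ vars e → v ∉ vars f
    separated none e∈Φ f∈Φ Pe ¬Pf v v∈e v∈f with k , refl ← member e∈Φ | l , refl ← member f∈Φ =
      ¬Pf (∈⇒P (trans (sym (same k l v v∈e v∈f)) (P⇒∈ k Pe)))
      where
      ends≡ : ∀ v → Vec.lookup B (end₁ v) ≡ Vec.lookup B (end₂ v)
      ends≡ v = decidable-stable (_ Bool.≟ _) λ neq → none (v , neq)
      side : ∀ v k → v ∈ scope k → Vec.lookup B k ≡ Vec.lookup B (end₁ v)
      side v k v∈k with ∈-ends v k v∈k
      ... | inj₁ refl = refl
      ... | inj₂ refl = sym (ends≡ v)
      same : ∀ k l v → v ∈ scope k → v ∈ scope l → Vec.lookup B k ≡ Vec.lookup B l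
      same k l v v∈k v∈l = trans (side v k v∈k) (sym (side v l v∈l))

  double-cut : ∀ c B → c ≤ cut (Vec.lookup B) → c + c ≤ D B
  double-cut c B c≤cut = subst (c + c ≤_) (sym (D≡2cut B)) (+-mono-≤ c≤cut c≤cut)

  delete-⊥ : delete ⊥ Φ ≡ Φ
  delete-⊥ = List.filter-all _ (All.tabulate λ {e} _ → All.tabulate {xs = vars e} λ _ → Subset.∉⊥)

  D≥2 : Connected Φ → ∀ B → 0 ℕ.< ∣ B ∣ → ∣ B ∣ ℕ.< m → fromℕ 2 ≤ D B
  D≥2 connected B 0<k k<m = double-cut 1ℚ B (begin
    1ℚ                                      ≡⟨ unit (Vec.lookup B (end₁ v)) (Vec.lookup B (end₂ v)) (proj₂ crossed) ⟨
    crossing (Vec.lookup B) v               ≤⟨ term≤∑ (crossing (Vec.lookup B)) (λ v → 0≤square (ι (Vec.lookup B (end₁ v)) - ι (Vec.lookup B (end₂ v)))) v ⟩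
    ∑ (allFin n) (crossing (Vec.lookup B))  ≡⟨ cut≡∑-crossing (Vec.lookup B) ⟨
    cut (Vec.lookup B)                      ∎)
    where
    open ≤-Reasoning
    crossed = crossing-variable connected B 0<k k<m
    v : Fin n
    v = proj₁ crossed
    unit : ∀ x y → x ≢ y → (ι x - ι y) * (ι x - ι y) ≡ 1ℚ
    unit true  true  neq = contradiction refl neq
    unit true  false neq = refl
    unit false true  neq = refl
    unit false false neq = contradiction refl neq

  private
    3≤k[4-k] : ∀ k → 0 ℕ.< k → k ℕ.< 4 → fromℕ 3 ≤ fromℕ k * (fromℕ 4 - fromℕ k)
    3≤k[4-k] 1 _ _ = ≤-refl
    3≤k[4-k] 2 _ _ = fromℕ-mono-≤ {3} {4} (ℕ.n≤1+n 3)
    3≤k[4-k] 3 _ _ = ≤-refl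
    3≤k[4-k] (suc (suc (suc (suc k)))) _ (ℕ.s≤s (ℕ.s≤s (ℕ.s≤s (ℕ.s≤s ()))))

  card-not : ∀ B → ∑ (allFin m) (ι ∘ not ∘ Vec.lookup B) ≡ fromℕ (m ℕ.∸ ∣ B ∣)
  card-not B = trans (ℚΣ.sum-cong (allFin m) λ i → cong ι (sym (Vec.lookup-map i not B)))
    (trans (card≡∣∣ (∁ B)) (cong fromℕ (Subset.∣∁p∣≡n∸∣p∣ B)))

  -- One of `B` and its complement has k ≤ 3 clauses, and k(4 - k) ≥ 3 for k = 1, 2, 3. The cut is
  -- the same from either side.
  D≥6 : m ℕ.≤ 7 → ∀ B → 0 ℕ.< ∣ B ∣ → ∣ B ∣ ℕ.< m → fromℕ 6 ≤ D B
  D≥6 m≤7 B 0<k k<m with ∣ B ∣ ℕ.<? 4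
  ... | yes k<4 = double-cut (fromℕ 3) B (≤-trans (3≤k[4-k] ∣ B ∣ 0<k k<4)
    (subst (λ K → K * (fromℕ 4 - K) ≤ cut (Vec.lookup B)) (card≡∣∣ B) (cut-bound (Vec.lookup B))))
  ... | no k≮4 = double-cut (fromℕ 3) B (≤-trans (3≤k[4-k] (m ℕ.∸ ∣ B ∣) (ℕ.m<n⇒0<n∸m k<m)
      (ℕ.s≤s (ℕ.m≤n+o⇒m∸n≤o m ∣ B ∣ (ℕ.≤-trans m≤7 (ℕ.+-monoˡ-≤ 3 (ℕ.≮⇒≥ k≮4))))))
    (subst₂ (λ K c → K * (fromℕ 4 - K) ≤ c) (card-not B) (cut-not (Vec.lookup B)) (cut-bound (not ∘ Vec.lookup B))))

  -- Both sides count the moves: two for each variable, three for each clause.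
  2n≡3m : n ℕ.* 2 ≡ m ℕ.* 3
  2n≡3m = fromℕ-injective {n ℕ.* 2} {m ℕ.* 3} (begin
    fromℕ (n ℕ.* 2)                     ≡⟨ fromℕ-* n 2 ⟩
    fromℕ n * fromℕ 2                   ≡⟨ cong (λ k → fromℕ k * fromℕ 2) (List.length-tabulate {n = n} (λ v → v)) ⟨
    fromℕ (length (allFin n)) * fromℕ 2 ≡⟨ ∑-const (fromℕ 2) (allFin n) ⟨
    ∑ (allFin n) (λ _ → 1ℚ + 1ℚ)        ≡⟨ Hℚ.sum-moves (λ _ → 1ℚ) ⟨
    ∑ moves (λ _ → 1ℚ)                  ≡⟨ ∑-moves-const 1ℚ ⟩
    3M * 1ℚ                             ≡⟨ *-identityʳ 3M ⟩
    3M                                  ≡⟨ fromℕ-* m 3 ⟨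
    fromℕ (m ℕ.* 3)                     ∎)
    where open ≡-Reasoning

  open Graph (T₃ Φ)

  adjacent : Fin m → Fin m → Bool
  adjacent i j = does (i ~? j)

  adjacent≤common : ∀ i j → ι (adjacent i j) ≤ common i j
  adjacent≤common i j = ι-does≤ (i ~? j) (λ (_ , v , v∈i , v∈j) → 1≤common v v∈i v∈j) (0≤common i j)

  common≤adjacent : ∀ {i j} → i ≢ j → common i j ≤ ι (adjacent i j)
  common≤adjacent {i} {j} i≢j = compare (any? (λ v → (v ∈? scope i) ×-dec (v ∈? scope j)))
    where
    compare : Dec (∃ λ v → v ∈ scope i × v ∈ scope j) → common i j ≤ ι (adjacent i j)
    compare (yes shared) = subst (λ b → common i j ≤ ι b) (sym (dec-true (i ~? j) (i≢j , shared))) (common≤1 i≢j)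
    compare (no none)    = ≤-trans (≤-reflexive (common-none λ v v∈i v∈j → none (v , v∈i , v∈j))) (0≤ι (adjacent i j))

  -- In the row sum 6 of `common`, the diagonal accounts for 3 and each neighbour for at most 1. A
  -- lower bound on degrees bounds the transition probabilities from above, as `flow≤` requires.
  3≤deg : ∀ i → 3 ℕ.≤ deg (T₃ Φ) i
  3≤deg i = ℕ.+-cancelʳ-≤ 3 3 (deg (T₃ Φ) i) (fromℕ-cancel-≤ {6} {deg (T₃ Φ) i ℕ.+ 3} (begin
    fromℕ 6                                                            ≡⟨ ∑-common i ⟨
    ∑ (allFin m) (common i)                                            ≤⟨ ∑-mono (allFin m) entry ⟩
    ∑ (allFin m) (λ j → ι (adjacent i j) + (if does (j ≟ i) then fromℕ 3 else 0ℚ))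
      ≡⟨ trans (ℚΣ.sum-∙ (allFin m) _ _) (cong₂ _+_ (sym degree) (ℚΣ.sum-δ i (λ _ → fromℕ 3))) ⟩
    fromℕ (deg (T₃ Φ) i) + fromℕ 3                                     ≡⟨ fromℕ-+ (deg (T₃ Φ) i) 3 ⟨
    fromℕ (deg (T₃ Φ) i ℕ.+ 3)                                         ∎))
    where
    open ≤-Reasoning
    degree : fromℕ (deg (T₃ Φ) i) ≡ ∑ (allFin m) (ι ∘ adjacent i)
    degree = trans (sym (*-identityʳ _)) (trans (sym (∑-const 1ℚ (filter (i ~?_) (allFin m)))) (ℚΣ.sum-filter (i ~?_) (allFin m) (λ _ → 1ℚ)))
    entry : ∀ j → common i j ≤ ι (adjacent i j) + (if does (j ≟ i) then fromℕ 3 else 0ℚ)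
    entry j with j ≟ i
    ... | yes refl = subst (_≤ ι (adjacent i i) + fromℕ 3) (sym (common-self i)) (≤-trans (p≤p+q (0≤ι (adjacent i i))) (≤-reflexive (+-comm (fromℕ 3) (ι (adjacent i i)))))
    ... | no j≢i   = ≤-trans (common≤adjacent (≢-sym j≢i)) (p≤p+q ≤-refl)

  -- Literally the denominator in `τ-C`, so that estimates of it apply to that supremum by
  -- definition.
  flow : Subset m → ℚ
  flow A = ∑ (elements (T₃ Φ) A) (λ i → ∑ (elements (T₃ Φ) (∁ A)) (λ j → π (T₃ Φ) ⁅ i ⁆ * p (T₃ Φ) i j))

  -- Each crossing variable carries at most 1/(3m). An upper estimate of the denominator is the
  -- right direction, since membership in the cut a ÷ b means q · b < a.
  flow≤ : ∀ A → flow A ≤ recip m * recip 3 * cut (Vec.lookup A)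
  flow≤ A = begin
    flow A
      ≡⟨ ℚΣ.sum-filter (Subset._∈? A) (allFin m) _ ⟩
    ∑ (allFin m) (λ i → if does (i Subset.∈? A) then ∑ (elements (T₃ Φ) (∁ A)) (λ j → π (T₃ Φ) ⁅ i ⁆ * p (T₃ Φ) i j) else 0ℚ)
      ≡⟨ ℚΣ.sum-cong (allFin m) (λ i → trans (cong₂ (λ b s → if b then s else 0ℚ) (does-∈? A i) (ℚΣ.sum-filter (Subset._∈? ∁ A) (allFin m) _)) (if-ι (Vec.lookup A i) _)) ⟩
    ∑ (allFin m) (λ i → ι (Vec.lookup A i) * ∑ (allFin m) (λ j → if does (j Subset.∈? ∁ A) then π (T₃ Φ) ⁅ i ⁆ * p (T₃ Φ) i j else 0ℚ))
      ≤⟨ ∑-mono (allFin m) (λ i → *ˡ-mono (0≤ι (Vec.lookup A i)) (∑-mono (allFin m) (entry i))) ⟩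
    ∑ (allFin m) (λ i → ι (Vec.lookup A i) * ∑ (allFin m) (λ j → c * (ι (not (Vec.lookup A j)) * common i j)))
      ≡⟨ ℚΣ.sum-cong (allFin m) (λ i → trans (sym (∑-*ˡ (ι (Vec.lookup A i)) (allFin m) _)) (trans (ℚΣ.sum-cong (allFin m) (λ j → regroup (ι (Vec.lookup A i)) c (ι (not (Vec.lookup A j))) (common i j))) (∑-*ˡ c (allFin m) _))) ⟩
    ∑ (allFin m) (λ i → c * ∑ (allFin m) (λ j → ι (Vec.lookup A i) * ι (not (Vec.lookup A j)) * common i j))
      ≡⟨ ∑-*ˡ c (allFin m) _ ⟩
    c * cut (Vec.lookup A) ∎
    where
    open ≤-Reasoning
    c : ℚ
    c = recip m * recip 3
    regroup : ∀ a c b x → a * (c * (b * x)) ≡ c * (a * b * x)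
    regroup = solve-∀ ℚ-ring
    does-∈? : ∀ (A : Subset m) i → does (i Subset.∈? A) ≡ Vec.lookup A i
    does-∈? A i with Vec.lookup A i in eq
    ... | true  = dec-true (i Subset.∈? A) (Vec.lookup⇒[]= i A eq)
    ... | false = dec-false (i Subset.∈? A) λ i∈A → contradiction (trans (sym eq) (Vec.[]=⇒lookup i∈A)) λ ()
    weight : ∀ i j → π (T₃ Φ) ⁅ i ⁆ * p (T₃ Φ) i j ≤ c * common i j
    weight i j = begin
      π (T₃ Φ) ⁅ i ⁆ * p (T₃ Φ) i j
        ≡⟨ cong₂ _*_ (trans (cong (λ k → fromℕ k * recip m) (Subset.∣⁅x⁆∣≡1 i)) (*-identityˡ (recip m))) (if-ι (adjacent i j) (recip (deg (T₃ Φ) i))) ⟩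
      recip m * (ι (adjacent i j) * recip (deg (T₃ Φ) i))
        ≤⟨ *ˡ-mono (0≤recip m) (*ˡ-mono (0≤ι (adjacent i j)) (recip-anti (3≤deg i))) ⟩
      recip m * (ι (adjacent i j) * recip 3)
        ≤⟨ *ˡ-mono (0≤recip m) (*ʳ-mono (0≤recip 3) (adjacent≤common i j)) ⟩
      recip m * (common i j * recip 3)
        ≡⟨ swap (recip m) (common i j) (recip 3) ⟩
      c * common i j ∎
      where
      swap : ∀ a b c → a * (b * c) ≡ a * c * b
      swap = solve-∀ ℚ-ring
    entry : ∀ i j → (if does (j Subset.∈? ∁ A) then π (T₃ Φ) ⁅ i ⁆ * p (T₃ Φ) i j else 0ℚ) ≤ c * (ι (not (Vec.lookup A j)) * common i j)
    entry i j = begin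
      (if does (j Subset.∈? ∁ A) then π (T₃ Φ) ⁅ i ⁆ * p (T₃ Φ) i j else 0ℚ)
        ≡⟨ trans (cong (λ b → if b then _ else 0ℚ) (trans (does-∈? (∁ A) j) (Vec.lookup-map j not A))) (if-ι (not (Vec.lookup A j)) _) ⟩
      ι (not (Vec.lookup A j)) * (π (T₃ Φ) ⁅ i ⁆ * p (T₃ Φ) i j)
        ≤⟨ *ˡ-mono (0≤ι (not (Vec.lookup A j))) (weight i j) ⟩
      ι (not (Vec.lookup A j)) * (c * common i j)
        ≡⟨ swap (ι (not (Vec.lookup A j))) c (common i j) ⟩
      c * (ι (not (Vec.lookup A j)) * common i j) ∎
      where
      swap : ∀ a b c → a * (b * c) ≡ b * (a * c)
      swap = solve-∀ ℚ-ring

-- Numerical estimates and the two final bounds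

0<fromℕ : ∀ {k} → 0 ℕ.< k → 0ℚ < fromℕ k
0<fromℕ {suc k} _ = 0<fromℕ-suc k

fromℕ-∸ : ∀ {k l} → l ℕ.≤ k → fromℕ (k ℕ.∸ l) ≡ fromℕ k - fromℕ l
fromℕ-∸ {k} {l} l≤k = trans (restore (fromℕ (k ℕ.∸ l)) (fromℕ l))
  (cong (_- fromℕ l) (trans (sym (fromℕ-+ (k ℕ.∸ l) l)) (cong fromℕ (ℕ.m∸n+n≡m l≤k))))
  where
  restore : ∀ x y → x ≡ x + y - y
  restore = solve-∀ ℚ-ring

inverse : ∀ {x} → 0ℚ < x → ∃ λ y → 0ℚ < y × y * x ≡ 1ℚ
inverse {x} 0<x = (1/ x) {{nz}} , positive⁻¹ _ {{1/pos⇒pos x {{positive 0<x}}}} , *-inverseˡ x {{nz}}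
  where nz = pos⇒nonZero x {{positive 0<x}}

0<-index : ∀ {k} → Fin k → 0 ℕ.< k
0<-index {suc k} _ = ℕ.s≤s ℕ.z≤n

-- For s = 3, after cancelling m, the claim is 9(m - 1) ≤ m². It holds from m = 8 on, where it reads
-- 63 ≤ 64, and fails at m = 7; this fixes the threshold between the two cut bounds.
large-count : ∀ {m s} → 8 ℕ.≤ m → s ℕ.≤ 3 → s ℕ.* (m ℕ.* 3 ℕ.* (m ℕ.∸ 1)) ℕ.≤ m ^ 3
large-count {m} {s} 8≤m s≤3 with r , refl ← ℕ.m≤n⇒∃[o]m+o≡n 8≤m = begin
  s ℕ.* ((8 ℕ.+ r) ℕ.* 3 ℕ.* (7 ℕ.+ r))    ≤⟨ ℕ.*-monoˡ-≤ ((8 ℕ.+ r) ℕ.* 3 ℕ.* (7 ℕ.+ r)) s≤3 ⟩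
  3 ℕ.* ((8 ℕ.+ r) ℕ.* 3 ℕ.* (7 ℕ.+ r))    ≤⟨ ℕ.m≤m+n _ _ ⟩
  3 ℕ.* ((8 ℕ.+ r) ℕ.* 3 ℕ.* (7 ℕ.+ r)) ℕ.+ (8 ℕ.+ r) ℕ.* (1 ℕ.+ 7 ℕ.* r ℕ.+ r ℕ.* r) ≡⟨ expand r ⟩
  (8 ℕ.+ r) ^ 3                            ∎
  where
  open ℕ.≤-Reasoning
  expand : ∀ r → 3 ℕ.* ((8 ℕ.+ r) ℕ.* 3 ℕ.* (7 ℕ.+ r)) ℕ.+ (8 ℕ.+ r) ℕ.* (1 ℕ.+ 7 ℕ.* r ℕ.+ r ℕ.* r) ≡ (8 ℕ.+ r) ℕ.* ((8 ℕ.+ r) ℕ.* ((8 ℕ.+ r) ℕ.* 1))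
  expand = ℕ-Solver.solve-∀

-- With the cut bound 3, after cancelling m, the claim is s(m - 1) ≤ m². The tight case is m = 4
-- with s = 5: 15 ≤ 16.
small-count : ∀ {m s} → 4 ℕ.≤ m → m ℕ.≤ 7 → (m ≡ 4 → s ℕ.≤ 5) → (5 ℕ.≤ m → s ℕ.≤ 3) →
  s ℕ.* (m ℕ.* (m ℕ.∸ 1)) ℕ.≤ m ^ 3
small-count {m} {s} 4≤m m≤7 s≤5 s≤3 with r , refl ← ℕ.m≤n⇒∃[o]m+o≡n 4≤m = bound r m≤7 s≤5 s≤3
  where
  bound : ∀ r → 4 ℕ.+ r ℕ.≤ 7 → (4 ℕ.+ r ≡ 4 → s ℕ.≤ 5) → (5 ℕ.≤ 4 ℕ.+ r → s ℕ.≤ 3) →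
    s ℕ.* ((4 ℕ.+ r) ℕ.* (3 ℕ.+ r)) ℕ.≤ (4 ℕ.+ r) ^ 3
  bound 0 _ s≤5 _ = ℕ.≤-trans (ℕ.*-monoˡ-≤ 12 (s≤5 refl)) (ℕ.≤ᵇ⇒≤ 60 64 tt)
  bound 1 _ _ s≤3 = ℕ.≤-trans (ℕ.*-monoˡ-≤ 20 (s≤3 (ℕ.≤ᵇ⇒≤ 5 5 tt))) (ℕ.≤ᵇ⇒≤ 60 125 tt)
  bound 2 _ _ s≤3 = ℕ.≤-trans (ℕ.*-monoˡ-≤ 30 (s≤3 (ℕ.≤ᵇ⇒≤ 5 6 tt))) (ℕ.≤ᵇ⇒≤ 90 216 tt)
  bound 3 _ _ s≤3 = ℕ.≤-trans (ℕ.*-monoˡ-≤ 42 (s≤3 (ℕ.≤ᵇ⇒≤ 5 7 tt))) (ℕ.≤ᵇ⇒≤ 126 343 tt)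
  bound (suc (suc (suc (suc r)))) m≤7 _ _ = contradiction m≤7 (ℕ.<⇒≱ (ℕ.m≤m+n 8 r))

-- The lower sum 1/3 + 1/4 for log 2 exceeds 9/16, and 15/8 · 9/16 > 1.
1∈2log2 : (⌜ fromℕ 2 ⌝ · log2) 1ℚ
1∈2log2 = inj₂ (+ 15 / 8 , + 9 / 16 , toWitness {a? = (+ 15 / 8) <? fromℕ 2} tt ,
  (2 , toWitness {a? = (+ 9 / 16) <? ∑ (upTo 2) (λ i → recip (2 ℕ.+ suc i))} tt) ,
  toWitness {a? = 0ℚ <? (+ 15 / 8)} tt , toWitness {a? = 0ℚ <? (+ 9 / 16)} tt , toWitness {a? = 1ℚ <? (+ 15 / 8) * (+ 9 / 16)} tt)

module Final {n : ℕ} (s : ℕ) (Φ : Formula n) (s≥1 : s ≥ 1) (reduced : Reduced Φ) (satisfiable : Satisfiable Φ)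
  (regular : 2-Regular Φ) (connected : s -Connected Φ) (i₀ : Fin (length Φ)) (t : ℕ) (σ : Assignment n) where

  0<m : 0 ℕ.< length Φ
  0<m = 0<-index i₀

  open Incidence Φ regular
  open Walk Φ regular satisfiable 0<m hiding (w)
  open Geometry Φ reduced regular satisfiable 0<m
  open Bounds Φ reduced regular satisfiable 0<m

  E : ℚ
  E = 𝔼 (steps Φ t σ) fromℕ

  3M[M-1] : 3M * (M - 1ℚ) ≡ fromℕ (m ℕ.* 3 ℕ.* (m ℕ.∸ 1))
  3M[M-1] = sym (trans (fromℕ-* (m ℕ.* 3) (m ℕ.∸ 1)) (cong₂ _*_ (fromℕ-* m 3) (fromℕ-∸ {m} {1} 0<m)))

  scale : ∀ X → fromℕ 2 * E ≤ fromℕ X → s ℕ.* X ℕ.≤ m ^ 3 → E * fromℕ (2 ℕ.* s) ≤ fromℕ (m ^ 3)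
  scale X 2E≤X sX≤m³ = begin
    E * fromℕ (2 ℕ.* s)        ≡⟨ cong (E *_) (fromℕ-* 2 s) ⟩
    E * (fromℕ 2 * fromℕ s)    ≡⟨ swap E (fromℕ 2) (fromℕ s) ⟩
    fromℕ s * (fromℕ 2 * E)    ≤⟨ *ˡ-mono (0≤fromℕ s) 2E≤X ⟩
    fromℕ s * fromℕ X          ≡⟨ fromℕ-* s X ⟨
    fromℕ (s ℕ.* X)            ≤⟨ fromℕ-mono-≤ {s ℕ.* X} {m ^ 3} sX≤m³ ⟩
    fromℕ (m ^ 3)              ∎
    where
    open ≤-Reasoning
    swap : ∀ a b c → a * (b * c) ≡ c * (b * a)
    swap = solve-∀ ℚ-ring

  Φ-connected : Connected Φ
  Φ-connected = subst Connected delete-⊥ (proj₂ connected ⊥ (subst (ℕ._< s) (sym (Subset.∣⊥∣≡0 n)) s≥1))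

  large : 8 ℕ.≤ m → E * fromℕ (2 ℕ.* s) ≤ fromℕ (m ^ 3)
  large 8≤m = scale (m ℕ.* 3 ℕ.* (m ℕ.∸ 1))
    (subst (fromℕ 2 * E ≤_) 3M[M-1] (expectation-bound (fromℕ 2) (0<fromℕ-suc 1) (D≥2 Φ-connected) t σ))
    (large-count 8≤m (s≤3 s connected (ℕ.≤-trans (ℕ.≤ᵇ⇒≤ 5 8 tt) 8≤m) i₀))

  small : m ℕ.≤ 7 → E * fromℕ (2 ℕ.* s) ≤ fromℕ (m ^ 3)
  small m≤7 = scale (m ℕ.* (m ℕ.∸ 1)) (*ˡ-cancel (0<fromℕ-suc 2) (begin
      fromℕ 3 * (fromℕ 2 * E)             ≡⟨ *-assoc (fromℕ 3) (fromℕ 2) E ⟨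
      fromℕ 6 * E                         ≤⟨ expectation-bound (fromℕ 6) (0<fromℕ-suc 5) (D≥6 m≤7) t σ ⟩
      3M * (M - 1ℚ)                       ≡⟨ swap M (fromℕ 3) (M - 1ℚ) ⟩
      fromℕ 3 * (M * (M - 1ℚ))            ≡⟨ cong (fromℕ 3 *_) (trans (fromℕ-* m (m ℕ.∸ 1)) (cong (M *_) (fromℕ-∸ {m} {1} 0<m))) ⟨
      fromℕ 3 * fromℕ (m ℕ.* (m ℕ.∸ 1))   ∎))
    (small-count (4≤m i₀) m≤7 s≤5 (λ 5≤m → s≤3 s connected 5≤m i₀))
    where
    open ≤-Reasoning
    swap : ∀ a b c → a * b * c ≡ b * (a * c)
    swap = solve-∀ ℚ-ring
    -- With four clauses any two are adjacent, so no pair can be separated as in `s≤3`. The bound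
    -- comes from s < n, which is part of s-connectedness, with n = 6.
    s≤5 : m ≡ 4 → s ℕ.≤ 5
    s≤5 m≡4 = ℕ.s≤s⁻¹ (subst (s ℕ.<_) n≡6 (proj₁ connected))
      where
      n≡6 : n ≡ 6
      n≡6 = ℕ.*-cancelʳ-≡ n 6 2 (trans 2n≡3m (cong (ℕ._* 3) m≡4))

  cubic-bound : E * fromℕ (2 ℕ.* s) ≤ fromℕ (m ^ 3)
  cubic-bound = [ (λ m≤7 → small (ℕ.s≤s⁻¹ m≤7)) , large ]′ (ℕ.<-≤-connex m 8)

  1<M : 1ℚ < M
  1<M = <-≤-trans (toWitness {a? = 1ℚ <? fromℕ 4} tt) (fromℕ-mono-≤ {4} {m} (4≤m i₀))

  0<M : 0ℚ < M
  0<M = 0<fromℕ 0<m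

  -- Were there no such B, expectation-bound with γ = 4m(m-1)/E would give 4m(m-1) ≤ 3m(m-1).
  SparseCut : Subset m → Set
  SparseCut B = (0 ℕ.< ∣ B ∣ × ∣ B ∣ ℕ.< m) × D B * E < fromℕ 4 * (M * (M - 1ℚ))

  sparse-cut : 0ℚ < E → ∃ SparseCut
  -- There are finitely many subsets and comparison of rationals is decidable, so refuting the
  -- absence of a sparse cut produces one.
  sparse-cut 0<E = decidable-stable (Subset.anySubset? λ B → ((0 ℕ.<? ∣ B ∣) ×-dec (∣ B ∣ ℕ.<? m)) ×-dec (_ <? _)) λ none →
    let E⁻¹ , 0<E⁻¹ , E⁻¹E≡1 = inverse 0<E
        γ = fromℕ 4 * (M * (M - 1ℚ)) * E⁻¹
        γ≤D : ∀ B → 0 ℕ.< ∣ B ∣ → ∣ B ∣ ℕ.< m → γ ≤ D B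
        γ≤D B 0<k k<m = begin
          γ                    ≤⟨ *ʳ-mono (<⇒≤ 0<E⁻¹) (≮⇒≥ λ lt → none (B , (0<k , k<m) , lt)) ⟩
          D B * E * E⁻¹        ≡⟨ commute (D B) E E⁻¹ ⟩
          D B * (E⁻¹ * E)      ≡⟨ trans (cong (D B *_) E⁻¹E≡1) (*-identityʳ (D B)) ⟩
          D B                  ∎
    in <⇒≱ {3M * (M - 1ℚ)} {fromℕ 4 * (M * (M - 1ℚ))} (begin-strict
      3M * (M - 1ℚ)                   ≡⟨ swap M (fromℕ 3) (M - 1ℚ) ⟩
      fromℕ 3 * (M * (M - 1ℚ))        <⟨ *ʳ-mono-< (0<* 0<M (p<q⇒0<q-p 1<M)) (toWitness {a? = fromℕ 3 <? fromℕ 4} tt) ⟩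
      fromℕ 4 * (M * (M - 1ℚ))        ∎) (begin
      fromℕ 4 * (M * (M - 1ℚ))        ≡⟨ trans (cong (fromℕ 4 * (M * (M - 1ℚ)) *_) E⁻¹E≡1) (*-identityʳ _) ⟨
      fromℕ 4 * (M * (M - 1ℚ)) * (E⁻¹ * E) ≡⟨ *-assoc (fromℕ 4 * (M * (M - 1ℚ))) E⁻¹ E ⟨
      γ * E                           ≤⟨ expectation-bound γ (0<* (0<* (0<fromℕ-suc 3) (0<* 0<M (p<q⇒0<q-p 1<M))) 0<E⁻¹) γ≤D t σ ⟩
      3M * (M - 1ℚ)                   ∎)
    where
    open ≤-Reasoning
    commute : ∀ d e x → d * e * x ≡ d * (x * e)
    commute = solve-∀ ℚ-ring
    swap : ∀ a b c → a * b * c ≡ b * (a * c)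
    swap = solve-∀ ℚ-ring

  M⁻¹ : ℚ
  M⁻¹ = recip m

  M⁻¹M≡1 : M⁻¹ * M ≡ 1ℚ
  M⁻¹M≡1 = cancel 0<m
    where
    cancel : ∀ {k} → 0 ℕ.< k → recip k * fromℕ k ≡ 1ℚ
    cancel {suc k} _ = recip-inverse k

  0<M⁻¹ : 0ℚ < M⁻¹
  0<M⁻¹ = ≰⇒> λ M⁻¹≤0 → <⇒≱ {0ℚ} {1ℚ} (0<fromℕ-suc 0) (subst₂ _≤_ M⁻¹M≡1 (*-zeroˡ M) (*ʳ-mono 0≤M M⁻¹≤0))

  -- The factors 3/2, 5/4 and 9/10 below leave strict room: 5/4 < 3/2, 9/10 < 1 and 1 < 5/4 · 9/10.
  E/M² : ℚ
  E/M² = E * (M⁻¹ * M⁻¹)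

  -- The flow is at most D/(6m), so 3/2 · E/m² times the flow is at most D · E/(4m³). Sparsity puts
  -- this below (m - 1)/m², the least value of `ψ` on proper sets divided by m². An optimal cut
  -- would give 2 · E/m²; relaxing 3 to 4 in `SparseCut` costs the factor 3/4.
  sparse⇒τ : 0ℚ < E → ∀ B → SparseCut B → (π (T₃ Φ) B * π (T₃ Φ) (∁ B) ÷ flow B) ((+ 3 / 2) * E/M²)
  sparse⇒τ 0<E B ((0<k , k<m) , sparse) = begin-strict
    (+ 3 / 2) * E/M² * flow B
      ≤⟨ *ˡ-mono (0≤* (toWitness {a? = 0ℚ ≤? (+ 3 / 2)} tt) (<⇒≤ (0<* 0<E (0<* 0<M⁻¹ 0<M⁻¹)))) (flow≤ B) ⟩
    (+ 3 / 2) * E/M² * (M⁻¹ * recip 3 * cut (Vec.lookup B))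
      ≡⟨ collect (+ 3 / 2) E M⁻¹ (recip 3) (cut (Vec.lookup B)) ⟩
    (+ 3 / 2) * recip 3 * (M⁻¹ * M⁻¹ * M⁻¹) * (cut (Vec.lookup B) * E)
      ≡⟨ halve (M⁻¹ * M⁻¹ * M⁻¹) (cut (Vec.lookup B)) E ⟩
    recip 4 * (M⁻¹ * M⁻¹ * M⁻¹) * ((cut (Vec.lookup B) + cut (Vec.lookup B)) * E)
      ≡⟨ cong (λ d → recip 4 * (M⁻¹ * M⁻¹ * M⁻¹) * (d * E)) (D≡2cut B) ⟨
    recip 4 * (M⁻¹ * M⁻¹ * M⁻¹) * (D B * E)
      <⟨ *ˡ-mono-< (0<* (toWitness {a? = 0ℚ <? recip 4} tt) (0<* (0<* 0<M⁻¹ 0<M⁻¹) 0<M⁻¹)) sparse ⟩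
    recip 4 * (M⁻¹ * M⁻¹ * M⁻¹) * (fromℕ 4 * (M * (M - 1ℚ)))
      ≡⟨ regroup (recip 4) M⁻¹ (fromℕ 4) M ⟩
    recip 4 * fromℕ 4 * (M⁻¹ * M) * (M⁻¹ * M⁻¹ * (M - 1ℚ))
      ≡⟨ trans (cong (λ z → recip 4 * fromℕ 4 * z * (M⁻¹ * M⁻¹ * (M - 1ℚ))) M⁻¹M≡1) (*-identityˡ _) ⟩
    M⁻¹ * M⁻¹ * (M - 1ℚ)
      ≤⟨ *ˡ-mono (0≤* (<⇒≤ 0<M⁻¹) (<⇒≤ 0<M⁻¹)) (M-1≤ψ B 0<k k<m) ⟩
    M⁻¹ * M⁻¹ * (card B * (M - card B))
      ≡⟨ factor M⁻¹ (card B) (M - card B) ⟩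
    card B * M⁻¹ * ((M - card B) * M⁻¹)
      ≡⟨ cong₂ (λ x y → x * M⁻¹ * (y * M⁻¹)) (card≡∣∣ B) complement ⟩
    π (T₃ Φ) B * π (T₃ Φ) (∁ B) ∎
    where
    open ≤-Reasoning
    collect : ∀ a e x r c → a * (e * (x * x)) * (x * r * c) ≡ a * r * (x * x * x) * (c * e)
    collect = solve-∀ ℚ-ring
    double : ∀ h y c e → (h + h) * y * (c * e) ≡ h * y * ((c + c) * e)
    double = solve-∀ ℚ-ring
    halve : ∀ y c e → (+ 3 / 2) * recip 3 * y * (c * e) ≡ recip 4 * y * ((c + c) * e)
    halve = double (recip 4)
    regroup : ∀ r x f M → r * (x * x * x) * (f * (M * (M - 1ℚ))) ≡ r * f * (x * M) * (x * x * (M - 1ℚ))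
    regroup = solve-∀ ℚ-ring
    factor : ∀ x k l → x * x * (k * l) ≡ k * x * (l * x)
    factor = solve-∀ ℚ-ring
    complement : M - card B ≡ fromℕ ∣ ∁ B ∣
    complement = trans (cong (λ z → M - z) (card≡∣∣ B)) (trans (sym (fromℕ-∸ {m} {∣ B ∣} (Subset.∣p∣≤n B))) (cong fromℕ (sym (Subset.∣∁p∣≡n∸∣p∣ B))))

  τ-bound : 0ℚ < E → τ-C (T₃ Φ) ((+ 3 / 2) * E/M²)
  τ-bound 0<E = proj₁ (sparse-cut 0<E) , sparse⇒τ 0<E (proj₁ (sparse-cut 0<E)) (proj₂ (sparse-cut 0<E))

  0<E/M² : 0ℚ < E → 0ℚ < E/M²
  0<E/M² 0<E = 0<* 0<E (0<* 0<M⁻¹ 0<M⁻¹)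

  2log2τ-bound : 0ℚ < E → (⌜ fromℕ 2 ⌝ · log2 · τ-C (T₃ Φ)) ((+ 5 / 4) * E/M²)
  2log2τ-bound 0<E = inj₂ (1ℚ , (+ 3 / 2) * E/M² , 1∈2log2 , τ-bound 0<E , 0<fromℕ-suc 0 ,
    0<* (toWitness {a? = 0ℚ <? (+ 3 / 2)} tt) (0<E/M² 0<E) ,
    subst ((+ 5 / 4) * E/M² <_) (sym (*-identityˡ ((+ 3 / 2) * E/M²))) (*ʳ-mono-< (0<E/M² 0<E) (toWitness {a? = (+ 5 / 4) <? (+ 3 / 2)} tt)))

  9/10*M²<M² : (+ 9 / 10) * (M * M) < fromℕ (m ^ 2)
  9/10*M²<M² = begin-strict
    (+ 9 / 10) * (M * M)   <⟨ *ʳ-mono-< (0<* 0<M 0<M) (toWitness {a? = (+ 9 / 10) <? 1ℚ} tt) ⟩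
    1ℚ * (M * M)           ≡⟨ trans (*-identityˡ (M * M)) (cong (M *_) (sym (*-identityʳ M))) ⟩
    M * (M * 1ℚ)           ≡⟨ trans (fromℕ-* m (m ℕ.* 1)) (cong (M *_) (fromℕ-* m 1)) ⟨
    fromℕ (m ^ 2)          ∎
    where open ≤-Reasoning

  E<9/8*E : 0ℚ < E → E < (+ 5 / 4) * E/M² * ((+ 9 / 10) * (M * M))
  E<9/8*E 0<E = begin-strict
    E                                                      ≡⟨ *-identityˡ E ⟨
    1ℚ * E                                                 <⟨ *ʳ-mono-< 0<E (toWitness {a? = 1ℚ <? (+ 5 / 4) * (+ 9 / 10)} tt) ⟩
    (+ 5 / 4) * (+ 9 / 10) * E                             ≡⟨ cong ((+ 5 / 4) * (+ 9 / 10) *_) (trans (cong (λ z → E * (z * z)) M⁻¹M≡1) (*-identityʳ E)) ⟨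
    (+ 5 / 4) * (+ 9 / 10) * (E * ((M⁻¹ * M) * (M⁻¹ * M))) ≡⟨ regroup (+ 5 / 4) (+ 9 / 10) E M⁻¹ M ⟩
    (+ 5 / 4) * E/M² * ((+ 9 / 10) * (M * M))              ∎
    where
    open ≤-Reasoning
    regroup : ∀ a b e x M → a * b * (e * ((x * M) * (x * M))) ≡ a * (e * (x * x)) * (b * (M * M))
    regroup = solve-∀ ℚ-ring

  conductance-bound : ⌜ E ⌝ ≤ᵣ ⌜ fromℕ 2 ⌝ · log2 · τ-C (T₃ Φ) · ⌜ fromℕ (m ^ 2) ⌝
  conductance-bound {q} q<E = compare (q <? 0ℚ)
    where
    compare : Dec (q < 0ℚ) → (⌜ fromℕ 2 ⌝ · log2 · τ-C (T₃ Φ) · ⌜ fromℕ (m ^ 2) ⌝) q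
    compare (yes q<0) = inj₁ q<0
    -- Negative rationals lie in every product by definition. A nonnegative `q` forces E > 0, which
    -- `sparse-cut` needs in order to divide by E.
    compare (no q≮0)  = inj₂ ((+ 5 / 4) * E/M² , (+ 9 / 10) * (M * M) , 2log2τ-bound 0<E , 9/10*M²<M² ,
      0<* (toWitness {a? = 0ℚ <? (+ 5 / 4)} tt) (0<E/M² 0<E) , 0<* (toWitness {a? = 0ℚ <? (+ 9 / 10)} tt) (0<* 0<M 0<M) ,
      <-trans q<E (E<9/8*E 0<E))
      where
      0<E : 0ℚ < E
      0<E = ≤-<-trans (≮⇒≥ q≮0) q<E

theorem5 : ∀ (n s : ℕ) (Φ : Formula n) → s ≥ 1 →
    Reduced Φ → Satisfiable Φ → 2-Regular Φ → s -Connected Φ →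
    let m = length Φ in
    ∀ (σ : Assignment n) →
    E[T-RW] Φ σ ≤ᵣ
    min (fromℕ (m ^ 3) ÷ fromℕ (2 ℕ.* s))
    (⌜ fromℕ 2 ⌝ · log2 · τ-C (T₃ Φ) · ⌜ fromℕ (m ^ 2) ⌝)
theorem5 zero    s       Φ s≥1 reduced satisfiable regular (() , _) σ _
-- Since n > s there is a variable, and a clause containing it shows that m > 0. A rational below
-- the supremum lies below one truncated expectation, which fixes `t`.
theorem5 (suc n) (suc s) Φ s≥1 reduced satisfiable regular connected σ (t , q<E) =
  <-≤-trans (*ʳ-mono-< (0<fromℕ {2 ℕ.* suc s} (ℕ.s≤s ℕ.z≤n)) q<E) cubic-bound , conductance-bound q<E
  where open Final (suc s) Φ s≥1 reduced satisfiable regular connected (Incidence.end₁ Φ regular zero) t σ
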